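{- The polynomials $P_n$ satisfy $P_0(y)=y-1$ and, for $n\ge1$, \[ P_n=nP_{n-1}-P'_{n-1}+\frac{1}{n}\sum_{k=1}^{n-1}k\bigl\{(k-1)P_{k-1}-P_k-P'_{k-1}\bigr\}P_{n-k-1}. \]
   Context: Let $A$ be the ring of formal series $a=\sum_{n=0}^\infty \frac{q_n(y)}{x^n}$, each $q_n$ a complex polynomial of degree at most $n$, with the obvious ring operations and the $x^{ -1}$-adic topology. Formal derivatives: $a_x=-\sum_{n\ge1}\frac{n q_n(y)}{x^{n+1}}$, $a_y=\sum_{n\ge1}\frac{q_n'(y)}{x^n}$. For $1+u\in A$ with $u$ having zero constant term, $\log(1+u)=\sum_{k\ge1}(-1)^{k+1}u^k/k$. Let $V$ be the unique solution in $A$ of $V=1+\frac{y}{x}-\frac{1}{x}V-V_x-\frac{1}{x}V_y+\frac{1}{x}\log V$, and define polynomials $P_{n-1}$ ($n\ge1$) by $V=1+\sum_{n=1}^\infty\frac{P_{n-1}(y)}{x^n}$. Primes denote derivatives in $y$. -}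

module Defs where

open import Algebra.Bundles using (CommutativeRing; RawMonoid; RawRing)
import Algebra.Definitions.RawMonoid
open import Data.Fin.Base as Fin using (Fin; toℕ)
open import Data.Fin.Properties using (toℕ≤pred[n])
open import Data.Integer.Base as ℤ using (+_)
open import Data.Nat.Base as ℕ using (ℕ; suc; zero; _∸_; _⊔_; NonZero; z≤n; s≤s)
import Data.Nat.Properties as ℕ
open import Data.Product.Base using (_×_; _,_; proj₁; proj₂; ∃-syntax)
open import Data.Rational.Base as ℚ using (ℚ; 0ℚ; 1ℚ; ½)
import Data.Rational.Properties as ℚ
import Data.Rational.Unnormalised.Base as ℚᵘ
import Data.Rational.Unnormalised.Properties as ℚᵘ
import Data.Integer.Properties as ℤ
open import Data.Rational.Solver using (module +-*-Solver)
open import Data.Sum.Base using (inj₁; inj₂)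
open import Level using (0ℓ)
import Level
open import Relation.Binary.PropositionalEquality using (_≡_; refl; sym; trans; cong; cong₂; subst)

------------------------------------------------------------------------
-- The real numbers: Cauchy sequences of rationals, where two sequences
-- are identified when their difference tends to 0.
-- (ℝ, ℂ, Poly and Series have no eta-equality and their operations are
-- defined by copatterns, so that conversion checking keeps applied
-- operations folded.)

record ℝ : Set where
  no-eta-equality
  field
    seq    : ℕ → ℚ
    cauchy : ∀ ε → 0ℚ ℚ.< ε → ∃[ N ] ∀ m n → N ℕ.≤ m → N ℕ.≤ n → ℚ.∣ seq m ℚ.- seq n ∣ ℚ.< ε

open ℝ public

infix 4 _≈ℝ_
infixl 6 _+ℝ_
infixl 7 _*ℝ_
infix 8 -ℝ_

_≈ℝ_ : ℝ → ℝ → Set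
x ≈ℝ y = ∀ ε → 0ℚ ℚ.< ε → ∃[ N ] ∀ n → N ℕ.≤ n → ℚ.∣ seq x n ℚ.- seq y n ∣ ℚ.< ε

private
  open +-*-Solver

  half : ∀ {ε} → 0ℚ ℚ.< ε → 0ℚ ℚ.< ½ ℚ.* ε
  half {ε} 0<ε = subst (ℚ._< ½ ℚ.* ε) (ℚ.*-zeroʳ ½) (ℚ.*-monoʳ-<-pos ½ 0<ε)

  halves : ∀ ε → ½ ℚ.* ε ℚ.+ ½ ℚ.* ε ≡ ε
  halves ε = trans (sym (ℚ.*-distribʳ-+ ε ½ ½)) (ℚ.*-identityˡ ε)

  ∣0∣< : ∀ {p ε} → p ≡ 0ℚ → 0ℚ ℚ.< ε → ℚ.∣ p ∣ ℚ.< ε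
  ∣0∣< refl 0<ε = 0<ε

  ∣+∣< : ∀ {p q ε} → ℚ.∣ p ∣ ℚ.< ½ ℚ.* ε → ℚ.∣ q ∣ ℚ.< ½ ℚ.* ε → ℚ.∣ p ℚ.+ q ∣ ℚ.< ε
  ∣+∣< {p} {q} {ε} p< q< =
    ℚ.≤-<-trans (ℚ.∣p+q∣≤∣p∣+∣q∣ p q) (subst (ℚ.∣ p ∣ ℚ.+ ℚ.∣ q ∣ ℚ.<_) (halves ε) (ℚ.+-mono-< p< q<))

  shrink : ∀ B ε → 0ℚ ℚ.< B → 0ℚ ℚ.< ε → ∃[ δ ] 0ℚ ℚ.< δ × B ℚ.* δ ≡ ε
  shrink B ε 0<B 0<ε = B⁻¹ ℚ.* ε , 0<δ , B*δ≡ε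
    where
    instance
      pos : ℚ.Positive B
      pos = ℚ.positive 0<B
      nz : ℚ.NonZero B
      nz = ℚ.pos⇒nonZero B
    B⁻¹ = ℚ.1/ B
    instance
      pos⁻¹ : ℚ.Positive B⁻¹
      pos⁻¹ = ℚ.1/pos⇒pos B
    0<δ : 0ℚ ℚ.< B⁻¹ ℚ.* ε
    0<δ = subst (ℚ._< B⁻¹ ℚ.* ε) (ℚ.*-zeroʳ B⁻¹) (ℚ.*-monoʳ-<-pos B⁻¹ 0<ε)
    B*δ≡ε : B ℚ.* (B⁻¹ ℚ.* ε) ≡ ε
    B*δ≡ε = trans (sym (ℚ.*-assoc B B⁻¹ ε)) (trans (cong (ℚ._* ε) (ℚ.*-inverseʳ B)) (ℚ.*-identityˡ ε))

  ∣*∣< : ∀ {p q B δ ε} → B ℚ.* δ ≡ ε → 0ℚ ℚ.< B → ℚ.∣ p ∣ ℚ.< B → ℚ.∣ q ∣ ℚ.< δ → ℚ.∣ p ℚ.* q ∣ ℚ.< ε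
  ∣*∣< {p} {q} {B} {δ} refl 0<B p< q< = subst (ℚ._< B ℚ.* δ) (sym (ℚ.∣p*q∣≡∣p∣*∣q∣ p q))
    (ℚ.≤-<-trans (ℚ.*-monoʳ-≤-nonNeg ℚ.∣ q ∣ {{ℚ.∣-∣-nonNeg q}} (ℚ.<⇒≤ p<))
                 (ℚ.*-monoʳ-<-pos B {{ℚ.positive 0<B}} q<))

  ∣-∣-swap : ∀ p q → ℚ.∣ p ℚ.- q ∣ ≡ ℚ.∣ q ℚ.- p ∣
  ∣-∣-swap p q = trans (cong ℚ.∣_∣ (solve 2 (λ p q → p :- q := :- (q :- p)) refl p q)) (ℚ.∣-p∣≡∣p∣ (q ℚ.- p))

  +-differences : ∀ {a b c d ε} → ℚ.∣ a ℚ.- c ∣ ℚ.< ½ ℚ.* ε → ℚ.∣ b ℚ.- d ∣ ℚ.< ½ ℚ.* ε →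
                  ℚ.∣ (a ℚ.+ b) ℚ.- (c ℚ.+ d) ∣ ℚ.< ε
  +-differences {a} {b} {c} {d} {ε} h k = subst (λ t → ℚ.∣ t ∣ ℚ.< ε)
    (solve 4 (λ a b c d → (a :- c) :+ (b :- d) := (a :+ b) :- (c :+ d)) refl a b c d)
    (∣+∣< h k)

  *-differences : ∀ {a b c d B C β γ ε} →
    0ℚ ℚ.< B → 0ℚ ℚ.< C → B ℚ.* β ≡ ½ ℚ.* ε → C ℚ.* γ ≡ ½ ℚ.* ε →
    ℚ.∣ a ∣ ℚ.< B → ℚ.∣ d ∣ ℚ.< C → ℚ.∣ b ℚ.- d ∣ ℚ.< β → ℚ.∣ a ℚ.- c ∣ ℚ.< γ →
    ℚ.∣ (a ℚ.* b) ℚ.- (c ℚ.* d) ∣ ℚ.< ε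
  *-differences {a} {b} {c} {d} {ε = ε} 0<B 0<C eB eC a< d< bd ac = subst (λ t → ℚ.∣ t ∣ ℚ.< ε)
    (solve 4 (λ a b c d → a :* (b :- d) :+ d :* (a :- c) := a :* b :- c :* d) refl a b c d)
    (∣+∣< (∣*∣< {p = a} eB 0<B a< bd) (∣*∣< {p = d} eC 0<C d< ac))

  bounded : (x : ℝ) → ∃[ B ] 0ℚ ℚ.< B × (∃[ N ] ∀ n → N ℕ.≤ n → ℚ.∣ seq x n ∣ ℚ.< B)
  bounded x with cauchy x 1ℚ (ℚ.positive⁻¹ 1ℚ)
  ... | N , near = B , 0<B , N , below
    where
    B = 1ℚ ℚ.+ ℚ.∣ seq x N ∣
    0<B : 0ℚ ℚ.< B
    0<B = ℚ.+-mono-<-≤ (ℚ.positive⁻¹ 1ℚ) (ℚ.0≤∣p∣ (seq x N))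
    below : ∀ n → N ℕ.≤ n → ℚ.∣ seq x n ∣ ℚ.< B
    below n N≤n = subst (λ t → ℚ.∣ t ∣ ℚ.< B)
      (solve 2 (λ p q → (p :- q) :+ q := p) refl (seq x n) (seq x N))
      (ℚ.≤-<-trans (ℚ.∣p+q∣≤∣p∣+∣q∣ (seq x n ℚ.- seq x N) (seq x N))
                   (ℚ.+-monoˡ-< ℚ.∣ seq x N ∣ (near n N N≤n ℕ.≤-refl)))

  ⊔ˡ : ∀ {M N n} → M ⊔ N ℕ.≤ n → M ℕ.≤ n
  ⊔ˡ {M} {N} = ℕ.≤-trans (ℕ.m≤m⊔n M N)

  ⊔ʳ : ∀ {M N n} → M ⊔ N ℕ.≤ n → N ℕ.≤ n
  ⊔ʳ {M} {N} = ℕ.≤-trans (ℕ.m≤n⊔m M N)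

fromℚ : ℚ → ℝ
seq (fromℚ p) _ = p
cauchy (fromℚ p) ε 0<ε = 0 , λ _ _ _ _ → ∣0∣< (ℚ.+-inverseʳ p) 0<ε

_+ℝ_ : ℝ → ℝ → ℝ
seq (x +ℝ y) n = seq x n ℚ.+ seq y n
cauchy (x +ℝ y) ε 0<ε =
  let (M , hx) = cauchy x (½ ℚ.* ε) (half 0<ε)
      (N , hy) = cauchy y (½ ℚ.* ε) (half 0<ε)
  in M ⊔ N , λ m n p q → +-differences {seq x m} (hx m n (⊔ˡ p) (⊔ˡ q)) (hy m n (⊔ʳ p) (⊔ʳ q))

-ℝ_ : ℝ → ℝ
seq (-ℝ x) n = ℚ.- seq x n
cauchy (-ℝ x) ε 0<ε =
  let (N , hx) = cauchy x ε 0<ε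
  in N , λ m n p q → subst (λ t → ℚ.∣ t ∣ ℚ.< ε)
       (solve 2 (λ a b → b :- a := (:- a) :- (:- b)) refl (seq x m) (seq x n)) (hx n m q p)

_*ℝ_ : ℝ → ℝ → ℝ
seq (x *ℝ y) n = seq x n ℚ.* seq y n
cauchy (x *ℝ y) ε 0<ε =
  let (B , 0<B , K , x<) = bounded x
      (C , 0<C , L , y<) = bounded y
      (β , 0<β , eB) = shrink B (½ ℚ.* ε) 0<B (half 0<ε)
      (γ , 0<γ , eC) = shrink C (½ ℚ.* ε) 0<C (half 0<ε)
      (M , hx) = cauchy x γ 0<γ
      (N , hy) = cauchy y β 0<β
  in (K ⊔ L) ⊔ (M ⊔ N) , λ m n p q →
       *-differences {a = seq x m} 0<B 0<C eB eC
         (x< m (⊔ˡ (⊔ˡ p))) (y< n (⊔ʳ {K} (⊔ˡ q)))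
         (hy m n (⊔ʳ {M} (⊔ʳ {K ⊔ L} p)) (⊔ʳ {M} (⊔ʳ {K ⊔ L} q)))
         (hx m n (⊔ˡ (⊔ʳ {K ⊔ L} p)) (⊔ˡ (⊔ʳ {K ⊔ L} q)))

private
  pointwise : ∀ {x y} → (∀ n → seq x n ≡ seq y n) → x ≈ℝ y
  pointwise {x} {y} x≡y ε 0<ε =
    0 , λ n _ → ∣0∣< (trans (cong (ℚ._- seq y n) (x≡y n)) (ℚ.+-inverseʳ (seq y n))) 0<ε

  ≈ℝ-sym : ∀ {x y} → x ≈ℝ y → y ≈ℝ x
  ≈ℝ-sym {x} {y} x≈y ε 0<ε =
    let (N , h) = x≈y ε 0<ε
    in N , λ n p → subst (ℚ._< ε) (∣-∣-swap (seq x n) (seq y n)) (h n p)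

  ≈ℝ-trans : ∀ {x y z} → x ≈ℝ y → y ≈ℝ z → x ≈ℝ z
  ≈ℝ-trans {x} {y} {z} x≈y y≈z ε 0<ε =
    let (M , h) = x≈y (½ ℚ.* ε) (half 0<ε)
        (N , k) = y≈z (½ ℚ.* ε) (half 0<ε)
    in M ⊔ N , λ n p → subst (λ t → ℚ.∣ t ∣ ℚ.< ε)
         (solve 3 (λ a b c → (a :- b) :+ (b :- c) := a :- c) refl (seq x n) (seq y n) (seq z n))
         (∣+∣< (h n (⊔ˡ p)) (k n (⊔ʳ p)))

  +ℝ-cong : ∀ {x y u v} → x ≈ℝ y → u ≈ℝ v → x +ℝ u ≈ℝ y +ℝ v
  +ℝ-cong {x} x≈y u≈v ε 0<ε =
    let (M , h) = x≈y (½ ℚ.* ε) (half 0<ε)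
        (N , k) = u≈v (½ ℚ.* ε) (half 0<ε)
    in M ⊔ N , λ n p → +-differences {seq x n} (h n (⊔ˡ p)) (k n (⊔ʳ p))

  -ℝ-cong : ∀ {x y} → x ≈ℝ y → -ℝ x ≈ℝ -ℝ y
  -ℝ-cong {x} {y} x≈y ε 0<ε =
    let (N , h) = ≈ℝ-sym {x} {y} x≈y ε 0<ε
    in N , λ n p → subst (λ t → ℚ.∣ t ∣ ℚ.< ε)
         (solve 2 (λ a b → b :- a := (:- a) :- (:- b)) refl (seq x n) (seq y n)) (h n p)

  *ℝ-cong : ∀ {x y u v} → x ≈ℝ y → u ≈ℝ v → x *ℝ u ≈ℝ y *ℝ v
  *ℝ-cong {x} {y} {u} {v} x≈y u≈v ε 0<ε =
    let (B , 0<B , K , x<) = bounded x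
        (C , 0<C , L , v<) = bounded v
        (β , 0<β , eB) = shrink B (½ ℚ.* ε) 0<B (half 0<ε)
        (γ , 0<γ , eC) = shrink C (½ ℚ.* ε) 0<C (half 0<ε)
        (M , hx) = x≈y γ 0<γ
        (N , hu) = u≈v β 0<β
    in (K ⊔ L) ⊔ (M ⊔ N) , λ n p →
         *-differences {a = seq x n} 0<B 0<C eB eC
           (x< n (⊔ˡ (⊔ˡ p))) (v< n (⊔ʳ {K} (⊔ˡ p)))
           (hu n (⊔ʳ {M} (⊔ʳ {K ⊔ L} p))) (hx n (⊔ˡ (⊔ʳ {K ⊔ L} p)))

------------------------------------------------------------------------
-- The complex numbers

infix 4 _≈ℂ_
infixl 6 _+ℂ_
infixl 7 _*ℂ_
infix 8 -ℂ_

record ℂ : Set where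
  no-eta-equality
  field
    re im : ℝ

open ℂ public

record _≈ℂ_ (z w : ℂ) : Set where
  constructor _,_
  field
    re-≈ : re z ≈ℝ re w
    im-≈ : im z ≈ℝ im w

_+ℂ_ : ℂ → ℂ → ℂ
re (z +ℂ w) = re z +ℝ re w
im (z +ℂ w) = im z +ℝ im w

-ℂ_ : ℂ → ℂ
re (-ℂ z) = -ℝ re z
im (-ℂ z) = -ℝ im z

_*ℂ_ : ℂ → ℂ → ℂ
re (z *ℂ w) = re z *ℝ re w +ℝ (-ℝ (im z *ℝ im w))
im (z *ℂ w) = re z *ℝ im w +ℝ im z *ℝ re w

0ℂ 1ℂ : ℂ
re 0ℂ = fromℚ 0ℚ
im 0ℂ = fromℚ 0ℚ
re 1ℂ = fromℚ 1ℚ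
im 1ℂ = fromℚ 0ℚ

private
  pointwiseℂ : ∀ {z w} → (∀ n → seq (re z) n ≡ seq (re w) n) → (∀ n → seq (im z) n ≡ seq (im w) n) → z ≈ℂ w
  pointwiseℂ {z} {w} p q = pointwise {re z} {re w} p , pointwise {im z} {im w} q

  ≈ℂ-refl : ∀ {z} → z ≈ℂ z
  ≈ℂ-refl = pointwiseℂ (λ _ → refl) (λ _ → refl)

  ≈ℂ-sym : ∀ {z w} → z ≈ℂ w → w ≈ℂ z
  ≈ℂ-sym {z} {w} (p , q) = ≈ℝ-sym {re z} {re w} p , ≈ℝ-sym {im z} {im w} q

  ≈ℂ-trans : ∀ {z w v} → z ≈ℂ w → w ≈ℂ v → z ≈ℂ v
  ≈ℂ-trans {z} {w} {v} (p , q) (r , s) =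
    ≈ℝ-trans {re z} {re w} {re v} p r , ≈ℝ-trans {im z} {im w} {im v} q s

  +ℂ-cong : ∀ {z w u v} → z ≈ℂ w → u ≈ℂ v → z +ℂ u ≈ℂ w +ℂ v
  +ℂ-cong {z} {w} {u} {v} (p , q) (r , s) =
    +ℝ-cong {re z} {re w} {re u} {re v} p r , +ℝ-cong {im z} {im w} {im u} {im v} q s

  -ℂ-cong : ∀ {z w} → z ≈ℂ w → -ℂ z ≈ℂ -ℂ w
  -ℂ-cong {z} {w} (p , q) = -ℝ-cong {re z} {re w} p , -ℝ-cong {im z} {im w} q

  *ℂ-cong : ∀ {z w u v} → z ≈ℂ w → u ≈ℂ v → z *ℂ u ≈ℂ w *ℂ v
  *ℂ-cong {z} {w} {u} {v} (p , q) (r , s) =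
      +ℝ-cong {re z *ℝ re u} {re w *ℝ re v} { -ℝ (im z *ℝ im u)} { -ℝ (im w *ℝ im v)}
        (*ℝ-cong {re z} {re w} {re u} {re v} p r)
        (-ℝ-cong {im z *ℝ im u} {im w *ℝ im v} (*ℝ-cong {im z} {im w} {im u} {im v} q s))
    , +ℝ-cong {re z *ℝ im u} {re w *ℝ im v} {im z *ℝ re u} {im w *ℝ re v}
        (*ℝ-cong {re z} {re w} {im u} {im v} p s)
        (*ℝ-cong {im z} {im w} {re u} {re v} q r)

  +ℂ-comm : ∀ z w → z +ℂ w ≈ℂ w +ℂ z
  +ℂ-comm z w = pointwiseℂ
    (λ n → ℚ.+-comm (seq (re z) n) (seq (re w) n)) (λ n → ℚ.+-comm (seq (im z) n) (seq (im w) n))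

  +ℂ-assoc : ∀ z w v → (z +ℂ w) +ℂ v ≈ℂ z +ℂ (w +ℂ v)
  +ℂ-assoc z w v = pointwiseℂ
    (λ n → ℚ.+-assoc (seq (re z) n) (seq (re w) n) (seq (re v) n))
    (λ n → ℚ.+-assoc (seq (im z) n) (seq (im w) n) (seq (im v) n))

  +ℂ-identityˡ : ∀ z → 0ℂ +ℂ z ≈ℂ z
  +ℂ-identityˡ z = pointwiseℂ (λ n → ℚ.+-identityˡ (seq (re z) n)) (λ n → ℚ.+-identityˡ (seq (im z) n))

  -ℂ-inverseˡ : ∀ z → (-ℂ z) +ℂ z ≈ℂ 0ℂ
  -ℂ-inverseˡ z = pointwiseℂ (λ n → ℚ.+-inverseˡ (seq (re z) n)) (λ n → ℚ.+-inverseˡ (seq (im z) n))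

  *ℂ-comm : ∀ z w → z *ℂ w ≈ℂ w *ℂ z
  *ℂ-comm z w = pointwiseℂ
    (λ n → solve 4 (λ a b c d → a :* c :+ :- (b :* d) := c :* a :+ :- (d :* b)) refl
             (seq (re z) n) (seq (im z) n) (seq (re w) n) (seq (im w) n))
    (λ n → solve 4 (λ a b c d → a :* d :+ b :* c := c :* b :+ d :* a) refl
             (seq (re z) n) (seq (im z) n) (seq (re w) n) (seq (im w) n))

  *ℂ-assoc : ∀ z w v → (z *ℂ w) *ℂ v ≈ℂ z *ℂ (w *ℂ v)
  *ℂ-assoc z w v = pointwiseℂ
    (λ n → solve 6 (λ a b c d e f →
             (a :* c :+ :- (b :* d)) :* e :+ :- ((a :* d :+ b :* c) :* f) :=
             a :* (c :* e :+ :- (d :* f)) :+ :- (b :* (c :* f :+ d :* e))) refl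
             (seq (re z) n) (seq (im z) n) (seq (re w) n) (seq (im w) n) (seq (re v) n) (seq (im v) n))
    (λ n → solve 6 (λ a b c d e f →
             (a :* c :+ :- (b :* d)) :* f :+ (a :* d :+ b :* c) :* e :=
             a :* (c :* f :+ d :* e) :+ b :* (c :* e :+ :- (d :* f))) refl
             (seq (re z) n) (seq (im z) n) (seq (re w) n) (seq (im w) n) (seq (re v) n) (seq (im v) n))

  *ℂ-identityˡ : ∀ z → 1ℂ *ℂ z ≈ℂ z
  *ℂ-identityˡ z = pointwiseℂ
    (λ n → solve 2 (λ a b → con 1ℚ :* a :+ :- (con 0ℚ :* b) := a) refl (seq (re z) n) (seq (im z) n))
    (λ n → solve 2 (λ a b → con 1ℚ :* b :+ con 0ℚ :* a := b) refl (seq (re z) n) (seq (im z) n))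

  *ℂ-distribˡ : ∀ z w v → z *ℂ (w +ℂ v) ≈ℂ (z *ℂ w) +ℂ (z *ℂ v)
  *ℂ-distribˡ z w v = pointwiseℂ
    (λ n → solve 6 (λ a b c d e f →
             a :* (c :+ e) :+ :- (b :* (d :+ f)) :=
             (a :* c :+ :- (b :* d)) :+ (a :* e :+ :- (b :* f))) refl
             (seq (re z) n) (seq (im z) n) (seq (re w) n) (seq (im w) n) (seq (re v) n) (seq (im v) n))
    (λ n → solve 6 (λ a b c d e f →
             a :* (d :+ f) :+ b :* (c :+ e) :=
             (a :* d :+ b :* c) :+ (a :* f :+ b :* e)) refl
             (seq (re z) n) (seq (im z) n) (seq (re w) n) (seq (im w) n) (seq (re v) n) (seq (im v) n))

ℂ-commutativeRing : CommutativeRing 0ℓ 0ℓ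
ℂ-commutativeRing = record
  { Carrier = ℂ
  ; _≈_ = _≈ℂ_
  ; _+_ = _+ℂ_
  ; _*_ = _*ℂ_
  ; -_ = -ℂ_
  ; 0# = 0ℂ
  ; 1# = 1ℂ
  ; isCommutativeRing = record
    { isRing = record
      { +-isAbelianGroup = record
        { isGroup = record
          { isMonoid = record
            { isSemigroup = record
              { isMagma = record
                { isEquivalence = record { refl = ≈ℂ-refl ; sym = ≈ℂ-sym ; trans = ≈ℂ-trans }
                ; ∙-cong = +ℂ-cong
                }
              ; assoc = +ℂ-assoc
              }
            ; identity = +ℂ-identityˡ , λ z → ≈ℂ-trans (+ℂ-comm z 0ℂ) (+ℂ-identityˡ z)
            }
          ; inverse = -ℂ-inverseˡ , λ z → ≈ℂ-trans (+ℂ-comm z (-ℂ z)) (-ℂ-inverseˡ z)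
          ; ⁻¹-cong = -ℂ-cong
          }
        ; comm = +ℂ-comm
        }
      ; *-cong = *ℂ-cong
      ; *-assoc = *ℂ-assoc
      ; *-identity = *ℂ-identityˡ , λ z → ≈ℂ-trans (*ℂ-comm z 1ℂ) (*ℂ-identityˡ z)
      ; distrib = *ℂ-distribˡ
                , λ z w v → ≈ℂ-trans (*ℂ-comm (w +ℂ v) z) (≈ℂ-trans (*ℂ-distribˡ z w v)
                    (+ℂ-cong {z *ℂ w} {w *ℂ z} {z *ℂ v} {v *ℂ z} (*ℂ-comm z w) (*ℂ-comm z v)))
      }
    ; *-comm = *ℂ-comm
    }
  }

module Sums {a ℓ} (M : RawMonoid a ℓ) where

  open RawMonoid M using (Carrier)
  open import Algebra.Definitions.RawMonoid M using (sum)

  -- ∑[1⋯ m ] f  =  f 1 + ⋯ + f m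
  ∑[1⋯_]_ : (m : ℕ) → ((k : ℕ) .{{_ : NonZero k}} → Carrier) → Carrier
  ∑[1⋯ m ] f = sum {m} (λ j → f (suc (toℕ j)))

  -- ∑[0⋯ m ] f  =  f 0 + ⋯ + f m
  ∑[0⋯_]_ : (m : ℕ) → (ℕ → Carrier) → Carrier
  ∑[0⋯ m ] f = sum {suc m} (λ j → f (toℕ j))

------------------------------------------------------------------------
-- Polynomials in y over R, and formal series in 1/x whose n-th
-- coefficient is such a polynomial of degree at most n.  recip n stands
-- for the element 1/n of R; the intended instance is R = ℂ, see below.

module FormalSeries {c ℓ} (R : CommutativeRing c ℓ)
                    (recip : (n : ℕ) .{{_ : NonZero n}} → CommutativeRing.Carrier R) where

  open CommutativeRing R hiding (zero; sym; trans; refl; _-_)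
  private module R = CommutativeRing R
  open import Algebra.Definitions.RawSemiring (RawRing.rawSemiring rawRing) using (_^_) renaming (_×_ to _ℕ×_)
  private
    open import Algebra.Definitions.RawMonoid +-rawMonoid using (sum)
    module ∑R = Sums +-rawMonoid

  ι : ℕ → Carrier
  ι n = n ℕ× 1#

  record Poly : Set (c Level.⊔ ℓ) where
    no-eta-equality
    field
      coeff  : ℕ → Carrier
      finite : ∃[ d ] ∀ i → d ℕ.< i → coeff i ≈ 0#

  open Poly public

  infix 4 _≈ₚ_ _≈ₛ_
  infixl 6 _+ₚ_ _-ₚ_ _+ₛ_ _-ₛ_
  infixl 7 _*ₚ_ _*ₛ_
  infixr 7 _·_ _·ₛ_
  infix 8 -ₚ_ -ₛ_
  infixr 8 _^ₛ_
  infix 9 _′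

  _≈ₚ_ : Poly → Poly → Set ℓ
  p ≈ₚ q = ∀ i → coeff p i ≈ coeff q i

  _HasDegree≤_ : Poly → ℕ → Set ℓ
  p HasDegree≤ d = ∀ i → d ℕ.< i → coeff p i ≈ 0#

  private
    -0≈0 : - 0# ≈ 0#
    -0≈0 = R.trans (R.sym (+-identityʳ (- 0#))) (-‿inverseˡ 0#)

    sum-zero : ∀ {n} (f : Fin n → Carrier) → (∀ j → f j ≈ 0#) → sum f ≈ 0#
    sum-zero {zero}  f f≈0 = R.refl
    sum-zero {suc n} f f≈0 =
      R.trans (+-cong (f≈0 Fin.zero) (sum-zero (λ j → f (Fin.suc j)) (λ j → f≈0 (Fin.suc j)))) (+-identityˡ 0#)

    conv-zero : ∀ {f g : ℕ → Carrier} {d e} →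
      (∀ i → d ℕ.< i → f i ≈ 0#) → (∀ i → e ℕ.< i → g i ≈ 0#) →
      ∀ i → d ℕ.+ e ℕ.< i → ∑R.∑[0⋯ i ] (λ k → f k * g (i ∸ k)) ≈ 0#
    conv-zero {f} {g} {d} {e} f≈0 g≈0 i d+e<i = sum-zero _ vanish
      where
      vanish : ∀ (j : Fin (suc i)) → f (toℕ j) * g (i ∸ toℕ j) ≈ 0#
      vanish j with ℕ.≤-<-connex (toℕ j) d
      ... | inj₂ d<j = R.trans (*-congʳ (f≈0 (toℕ j) d<j)) (zeroˡ _)
      ... | inj₁ j≤d = R.trans (*-congˡ (g≈0 (i ∸ toℕ j) e<i∸j)) (zeroʳ _)
        where
        e<i∸j : e ℕ.< i ∸ toℕ j
        e<i∸j = ℕ.≤-trans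
          (ℕ.≤-trans (ℕ.≤-reflexive (sym (ℕ.m+n∸m≡n d (suc e))))
                     (ℕ.∸-monoˡ-≤ d (subst (ℕ._≤ i) (sym (ℕ.+-suc d e)) d+e<i)))
          (ℕ.∸-monoʳ-≤ i j≤d)

  const : Carrier → Poly
  coeff (const r) zero    = r
  coeff (const r) (suc _) = 0#
  finite (const r) = 0 , λ { (suc _) _ → R.refl }

  0ₚ 1ₚ : Poly
  0ₚ = const 0#
  1ₚ = const 1#

  Y : Poly
  coeff Y 1 = 1#
  coeff Y _ = 0#
  finite Y = 1 , λ { (suc zero) (s≤s ()) ; (suc (suc _)) _ → R.refl }

  _+ₚ_ : Poly → Poly → Poly
  coeff (p +ₚ q) i = coeff p i + coeff q i
  finite (p +ₚ q) =
    let (d , p≈0) = finite p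
        (e , q≈0) = finite q
    in d ⊔ e , λ i h → R.trans (+-cong (p≈0 i (ℕ.m⊔n<o⇒m<o d e h)) (q≈0 i (ℕ.m⊔n<o⇒n<o d e h)))
                               (+-identityˡ 0#)

  -ₚ_ : Poly → Poly
  coeff (-ₚ p) i = - coeff p i
  finite (-ₚ p) = let (d , p≈0) = finite p in d , λ i h → R.trans (-‿cong (p≈0 i h)) -0≈0

  _-ₚ_ : Poly → Poly → Poly
  p -ₚ q = p +ₚ (-ₚ q)

  _·_ : Carrier → Poly → Poly
  coeff (r · p) i = r * coeff p i
  finite (r · p) = let (d , p≈0) = finite p in d , λ i h → R.trans (*-congˡ (p≈0 i h)) (zeroʳ r)

  _*ₚ_ : Poly → Poly → Poly
  coeff (p *ₚ q) i = ∑R.∑[0⋯ i ] (λ k → coeff p k * coeff q (i ∸ k))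
  finite (p *ₚ q) =
    let (d , p≈0) = finite p
        (e , q≈0) = finite q
    in d ℕ.+ e , conv-zero p≈0 q≈0

  _′ : Poly → Poly
  coeff (p ′) i = ι (suc i) * coeff p (suc i)
  finite (p ′) =
    let (d , p≈0) = finite p
    in d , λ i h → R.trans (*-congˡ (p≈0 (suc i) (ℕ.m<n⇒m<1+n h))) (zeroʳ _)

  +ₚ-rawMonoid : RawMonoid (c Level.⊔ ℓ) ℓ
  +ₚ-rawMonoid = record { Carrier = Poly ; _≈_ = _≈ₚ_ ; _∙_ = _+ₚ_ ; ε = 0ₚ }

  open Sums +ₚ-rawMonoid public

  private
    module ∑P = Algebra.Definitions.RawMonoid +ₚ-rawMonoid

    0ₚ-coeff : ∀ i → coeff 0ₚ i ≈ 0#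
    0ₚ-coeff zero    = R.refl
    0ₚ-coeff (suc _) = R.refl

    sum-coeff : ∀ {m} (f : Fin m → Poly) i → coeff (∑P.sum f) i ≈ sum (λ j → coeff (f j) i)
    sum-coeff {zero}  f i = 0ₚ-coeff i
    sum-coeff {suc m} f i = +-congˡ (sum-coeff (λ j → f (Fin.suc j)) i)

    sum-degree : ∀ {m n} (f : Fin m → Poly) → (∀ j → f j HasDegree≤ n) → ∑P.sum f HasDegree≤ n
    sum-degree f f≤n i h = R.trans (sum-coeff f i) (sum-zero _ (λ j → f≤n j i h))

  -- The ring A: term a n is the coefficient q_n(y) of 1/x^n.
  record Series : Set (c Level.⊔ ℓ) where
    no-eta-equality
    field
      term   : ℕ → Poly
      degree : ∀ n → term n HasDegree≤ n

  open Series public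

  _≈ₛ_ : Series → Series → Set ℓ
  a ≈ₛ b = ∀ n → term a n ≈ₚ term b n

  0ₛ 1ₛ x⁻¹ y/x : Series
  term   0ₛ _ = 0ₚ
  degree 0ₛ _ i _ = 0ₚ-coeff i
  term   1ₛ zero    = 1ₚ
  term   1ₛ (suc _) = 0ₚ
  degree 1ₛ zero    (suc _) _ = R.refl
  degree 1ₛ (suc _) i       _ = 0ₚ-coeff i
  term   x⁻¹ 1 = 1ₚ
  term   x⁻¹ _ = 0ₚ
  degree x⁻¹ 0 i _ = 0ₚ-coeff i
  degree x⁻¹ 1 (suc _) _ = R.refl
  degree x⁻¹ (suc (suc _)) i _ = 0ₚ-coeff i
  term   y/x 1 = Y
  term   y/x _ = 0ₚ
  degree y/x 0 i _ = 0ₚ-coeff i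
  degree y/x 1 = proj₂ (finite Y)
  degree y/x (suc (suc _)) i _ = 0ₚ-coeff i

  _+ₛ_ : Series → Series → Series
  term (a +ₛ b) n = term a n +ₚ term b n
  degree (a +ₛ b) n i h = R.trans (+-cong (degree a n i h) (degree b n i h)) (+-identityˡ 0#)

  -ₛ_ : Series → Series
  term (-ₛ a) n = -ₚ term a n
  degree (-ₛ a) n i h = R.trans (-‿cong (degree a n i h)) -0≈0

  _-ₛ_ : Series → Series → Series
  a -ₛ b = a +ₛ (-ₛ b)

  _·ₛ_ : Carrier → Series → Series
  term (r ·ₛ a) n = r · term a n
  degree (r ·ₛ a) n i h = R.trans (*-congˡ (degree a n i h)) (zeroʳ r)

  _*ₛ_ : Series → Series → Series
  term (a *ₛ b) n = ∑[0⋯ n ] (λ k → term a k *ₚ term b (n ∸ k))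
  degree (a *ₛ b) n = sum-degree {suc n} (λ j → term a (toℕ j) *ₚ term b (n ∸ toℕ j)) (λ j i h →
        conv-zero (degree a (toℕ j)) (degree b (n ∸ toℕ j)) i
          (subst (ℕ._< i) (sym (ℕ.m+[n∸m]≡n (toℕ≤pred[n] j))) h))

  _^ₛ_ : Series → ℕ → Series
  a ^ₛ zero  = 1ₛ
  a ^ₛ suc k = a *ₛ a ^ₛ k

  ∂x ∂y : Series → Series
  term   (∂x a) zero    = 0ₚ
  term   (∂x a) (suc n) = -ₚ (ι n · term a n)
  degree (∂x a) zero    i _ = 0ₚ-coeff i
  degree (∂x a) (suc n) i h =
    R.trans (-‿cong (R.trans (*-congˡ (degree a n i (ℕ.<-trans (ℕ.n<1+n n) h))) (zeroʳ (ι n)))) -0≈0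
  term   (∂y a) zero      = 0ₚ
  term   (∂y a) n@(suc _) = term a n ′
  degree (∂y a) zero      i _ = 0ₚ-coeff i
  degree (∂y a) n@(suc _) i h =
    R.trans (*-congˡ (degree a n (suc i) (ℕ.m<n⇒m<1+n h))) (zeroʳ (ι (suc i)))

  -- convergence in the x⁻¹-adic topology
  _⟶_ : (ℕ → Series) → Series → Set ℓ
  s ⟶ a = ∀ N → ∃[ K ] ∀ m → K ℕ.≤ m → ∀ n → n ℕ.≤ N → term (s m) n ≈ₚ term a n

  logSummand : Series → (k : ℕ) .{{_ : NonZero k}} → Series
  logSummand u k = ((- 1#) ^ (k ℕ.+ 1) * recip k) ·ₛ (u ^ₛ k)

  -- log a = ∑_{k≥1} (-1)^(k+1) (a - 1)^k / k.  As a - 1 has no constant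
  -- term, (a - 1)^k contributes to the coefficient of 1/x^n only for
  -- k ≤ n; log-converges below shows that this is the x⁻¹-adic sum.
  log : (a : Series) → term a 0 ≈ₚ 1ₚ → Series
  term (log a _) n = ∑[1⋯ n ] (λ k → term (logSummand (a -ₛ 1ₛ) k) n)
  degree (log a _) n = sum-degree {n} (λ j → term (logSummand (a -ₛ 1ₛ) (suc (toℕ j))) n)
                                (λ j → degree (logSummand (a -ₛ 1ₛ) (suc (toℕ j))) n)

  +ₛ-rawMonoid : RawMonoid (c Level.⊔ ℓ) ℓ
  +ₛ-rawMonoid = record { Carrier = Series ; _≈_ = _≈ₛ_ ; _∙_ = _+ₛ_ ; ε = 0ₛ }

  module ∑ₛ = Sums +ₛ-rawMonoid

  private
    module ∑S = Algebra.Definitions.RawMonoid +ₛ-rawMonoid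

    sum-term : ∀ {m} (f : Fin m → Series) n i →
               coeff (term (∑S.sum f) n) i ≈ sum (λ j → coeff (term (f j) n) i)
    sum-term {zero}  f n i = 0ₚ-coeff i
    sum-term {suc m} f n i = +-congˡ (sum-term (λ j → f (Fin.suc j)) n i)

    sum-extend : ∀ n m (f : ℕ → Carrier) → n ℕ.≤ m → (∀ k → n ℕ.≤ k → f k ≈ 0#) →
                 sum {m} (λ j → f (toℕ j)) ≈ sum {n} (λ j → f (toℕ j))
    sum-extend zero    m       f _         f≈0 = sum-zero {m} _ (λ j → f≈0 (toℕ j) z≤n)
    sum-extend (suc n) (suc m) f (s≤s n≤m) f≈0 =
      +-congˡ (sum-extend n m (λ k → f (suc k)) n≤m (λ k n≤k → f≈0 (suc k) (s≤s n≤k)))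

    *ₚ-zeroˡ : ∀ p q → p ≈ₚ 0ₚ → p *ₚ q ≈ₚ 0ₚ
    *ₚ-zeroˡ p q p≈0 i = R.trans
      (sum-zero {suc i} (λ j → coeff p (toℕ j) * coeff q (i ∸ toℕ j))
        (λ j → R.trans (*-congʳ (R.trans (p≈0 (toℕ j)) (0ₚ-coeff (toℕ j)))) (zeroˡ _)))
      (R.sym (0ₚ-coeff i))

    *ₚ-zeroʳ : ∀ p q → q ≈ₚ 0ₚ → p *ₚ q ≈ₚ 0ₚ
    *ₚ-zeroʳ p q q≈0 i = R.trans
      (sum-zero {suc i} (λ j → coeff p (toℕ j) * coeff q (i ∸ toℕ j))
        (λ j → R.trans (*-congˡ (R.trans (q≈0 (i ∸ toℕ j)) (0ₚ-coeff (i ∸ toℕ j)))) (zeroʳ _)))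
      (R.sym (0ₚ-coeff i))

    ^ₛ-order : ∀ u → term u 0 ≈ₚ 0ₚ → ∀ k n → n ℕ.< k → term (u ^ₛ k) n ≈ₚ 0ₚ
    ^ₛ-order u u₀ (suc k) n (s≤s n≤k) i = R.trans (sum-coeff summand i)
      (R.trans (sum-zero (λ j → coeff (summand j) i) (λ j → R.trans (vanish (toℕ j) (toℕ≤pred[n] j) i) (0ₚ-coeff i)))
               (R.sym (0ₚ-coeff i)))
      where
      summand : Fin (suc n) → Poly
      summand j = term u (toℕ j) *ₚ term (u ^ₛ k) (n ∸ toℕ j)
      vanish : ∀ l → l ℕ.≤ n → term u l *ₚ term (u ^ₛ k) (n ∸ l) ≈ₚ 0ₚ
      vanish zero    _   = *ₚ-zeroˡ (term u 0) (term (u ^ₛ k) n) u₀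
      vanish (suc l) l<n = *ₚ-zeroʳ (term u (suc l)) (term (u ^ₛ k) (n ∸ suc l))
        (^ₛ-order u u₀ k (n ∸ suc l) (ℕ.<-≤-trans (ℕ.∸-monoʳ-< {n} (s≤s z≤n) l<n) n≤k))

  log-converges : ∀ a (a₀ : term a 0 ≈ₚ 1ₚ) →
                  (λ m → ∑ₛ.∑[1⋯ m ] (logSummand (a -ₛ 1ₛ))) ⟶ log a a₀
  log-converges a a₀ N = N , λ m N≤m n n≤N i → R.trans
    (sum-term {m} (λ j → logSummand u (suc (toℕ j))) n i)
    (R.trans
      (sum-extend n m (λ k → coeff (term (logSummand u (suc k)) n) i) (ℕ.≤-trans n≤N N≤m)
        (λ k n≤k → R.trans
          (*-congˡ (R.trans (^ₛ-order u u₀ (suc k) n (s≤s n≤k) i) (0ₚ-coeff i)))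
          (zeroʳ _)))
      (R.sym (sum-coeff {n} (λ j → term (logSummand u (suc (toℕ j))) n) i)))
    where
    u = a -ₛ 1ₛ
    u₀ : term u 0 ≈ₚ 0ₚ
    u₀ i = R.trans (+-congʳ (a₀ i)) (R.trans (-‿inverseʳ (coeff 1ₚ i)) (R.sym (0ₚ-coeff i)))

ℂ-recip : (n : ℕ) .{{_ : NonZero n}} → ℂ
re (ℂ-recip n) = fromℚ (+ 1 ℚ./ n)
im (ℂ-recip n) = fromℚ 0ℚ

open FormalSeries ℂ-commutativeRing ℂ-recip public

private
  open ℚᵘ.≃-Reasoning

  re-ι : ∀ n k → seq (re (ι n)) k ≡ + n ℚ./ 1
  re-ι zero    k = refl
  re-ι (suc n) k = trans (cong (1ℚ ℚ.+_) (re-ι n k)) (ℚ.toℚᵘ-injective (begin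
    ℚ.toℚᵘ (1ℚ ℚ.+ + n ℚ./ 1)
      ≈⟨ ℚ.toℚᵘ-homo-+ 1ℚ (+ n ℚ./ 1) ⟩
    ℚ.toℚᵘ 1ℚ ℚᵘ.+ ℚ.toℚᵘ (+ n ℚ./ 1)
      ≈⟨ ℚᵘ.+-congʳ (ℚ.toℚᵘ 1ℚ) (ℚ.toℚᵘ-fromℚᵘ (+ n ℚᵘ./ 1)) ⟩
    ℚ.toℚᵘ 1ℚ ℚᵘ.+ + n ℚᵘ./ 1
      ≈⟨ ℚᵘ.*≡* (cong (λ t → (+ 1 ℤ.+ t) ℤ.* + 1) (ℤ.*-identityʳ (+ n))) ⟩
    + suc n ℚᵘ./ 1
      ≈⟨ ℚ.toℚᵘ-fromℚᵘ (+ suc n ℚᵘ./ 1) ⟨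
    ℚ.toℚᵘ (+ suc n ℚ./ 1) ∎))

  im-ι : ∀ n k → seq (im (ι n)) k ≡ 0ℚ
  im-ι zero    k = refl
  im-ι (suc n) k = trans (ℚ.+-identityˡ (seq (im (ι n)) k)) (im-ι n k)

  n/1*1/n≡1 : ∀ n .{{_ : NonZero n}} → (+ n ℚ./ 1) ℚ.* (+ 1 ℚ./ n) ≡ 1ℚ
  n/1*1/n≡1 n@(suc _) = ℚ.toℚᵘ-injective (begin
    ℚ.toℚᵘ ((+ n ℚ./ 1) ℚ.* (+ 1 ℚ./ n))
      ≈⟨ ℚ.toℚᵘ-homo-* (+ n ℚ./ 1) (+ 1 ℚ./ n) ⟩
    ℚ.toℚᵘ (+ n ℚ./ 1) ℚᵘ.* ℚ.toℚᵘ (+ 1 ℚ./ n)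
      ≈⟨ ℚᵘ.*-cong (ℚ.toℚᵘ-fromℚᵘ (+ n ℚᵘ./ 1)) (ℚ.toℚᵘ-fromℚᵘ (+ 1 ℚᵘ./ n)) ⟩
    (+ n ℚᵘ./ 1) ℚᵘ.* (+ 1 ℚᵘ./ n)
      ≈⟨ ℚᵘ.*≡* (trans (ℤ.*-identityʳ (+ n ℤ.* + 1)) (trans (ℤ.*-comm (+ n) (+ 1)) (sym (ℤ.*-identityˡ (+ 1 ℤ.* + n))))) ⟩
    ℚ.toℚᵘ 1ℚ ∎)

ℂ-recip-inverse : ∀ n .{{_ : NonZero n}} → ι n *ℂ ℂ-recip n ≈ℂ 1ℂ
ℂ-recip-inverse n = pointwiseℂ
  (λ k → trans (cong₂ (λ a b → a ℚ.* (+ 1 ℚ./ n) ℚ.+ ℚ.- (b ℚ.* 0ℚ)) (re-ι n k) (im-ι n k))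
               (trans (ℚ.+-identityʳ _) (n/1*1/n≡1 n)))
  (λ k → trans (cong₂ (λ a b → a ℚ.* 0ℚ ℚ.+ b ℚ.* (+ 1 ℚ./ n)) (re-ι n k) (im-ι n k))
               (cong₂ ℚ._+_ (ℚ.*-zeroʳ (+ n ℚ./ 1)) (ℚ.*-zeroˡ (+ 1 ℚ./ n))))

{-# OPTIONS --safe #-}
module Submission where

-- Read the equation in degree k + 1 (k ≥ 1): the coefficients L_k of log V are
-- L_k = P_k - (k-1) P_{k-1} + P'_{k-1}.  The Euler derivation θ, multiplying the
-- coefficient of 1/x^n by n, satisfies V · θ(log V) = θ V; in degree n this reads
-- n L_n + ∑_{0<k<n} k L_k P_{n-k-1} = n P_{n-1}, and eliminating the L_k gives the
-- recurrence.

open import Algebra.Bundles using (CommutativeRing; CommutativeSemiring; RawRing)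
import Algebra.Definitions.RawSemiring
import Algebra.Properties.Semiring.Mult
open import Algebra.Structures.Biased using (isCommutativeSemiringˡ)
open import Data.Fin.Base as Fin using (Fin; toℕ)
open import Data.Fin.Properties using (toℕ≤pred[n])
open import Data.Nat.Base as ℕ using (zero; _⊔_; _<_; _≤_; s≤s; z≤n)
open import Data.Nat.Base using (ℕ; suc; _∸_; NonZero)
import Data.Nat.Properties as ℕ
open import Data.Product.Base using (_,_; proj₁; proj₂)
open import Data.Product.Base using (_×_)
open import Defs using (module FormalSeries)
import Level
import Relation.Binary.Reasoning.Setoid
open import Relation.Binary.PropositionalEquality as ≡ using ()
open import Relation.Binary.Structures using (IsEquivalence)

-- Derivations on a commutative semiring and truncated logarithms

module Derivations {c ℓ} (T : CommutativeSemiring c ℓ) where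

  open CommutativeSemiring T hiding (zero)
  open import Algebra.Definitions.RawMonoid +-rawMonoid using (sum)
  open import Algebra.Properties.Semiring.Mult semiring renaming (_×_ to _ℕ×_)
  open import Algebra.Properties.Semiring.Sum semiring using (*-distribˡ-sum)
  open import Algebra.Definitions.RawSemiring rawSemiring using (_^_)
  open import Algebra.Solver.Ring.NaturalCoefficients.Default T using (solve; _:=_; _:+_; _:*_; con)
  open Relation.Binary.Reasoning.Setoid setoid

  record IsDerivation (D : Carrier → Carrier) : Set (c Level.⊔ ℓ) where
    field
      D-cong  : ∀ {f g} → f ≈ g → D f ≈ D g
      D-0#    : D 0# ≈ 0#
      D-+     : ∀ f g → D (f + g) ≈ D f + D g
      leibniz : ∀ f g → D (f * g) ≈ D f * g + f * D g

  -- Subtraction-free telescoping: `h k` plays the role of `G k - G (suc k)`. The induction peels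
  -- off the first term and shifts both sequences, which is how `sum` unfolds.
  sum-telescope : ∀ (h G : ℕ → Carrier) → (∀ k → h k + G (suc k) ≈ G k) →
                  ∀ m → sum {m} (λ j → h (toℕ j)) + G m ≈ G 0
  sum-telescope h G step zero    = +-identityˡ (G 0)
  sum-telescope h G step (suc m) = begin
    (h 0 + sum {m} (λ j → h (suc (toℕ j)))) + G (suc m)  ≈⟨ +-assoc _ _ _ ⟩
    h 0 + (sum {m} (λ j → h (suc (toℕ j))) + G (suc m))
      ≈⟨ +-congˡ (sum-telescope (λ k → h (suc k)) (λ k → G (suc k)) (λ k → step (suc k)) m) ⟩
    h 0 + G 1                                            ≈⟨ step 0 ⟩
    G 0                                                  ∎

  module _ {D : Carrier → Carrier} (isDerivation : IsDerivation D) where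

    open IsDerivation isDerivation

    D-sum : ∀ {m} (f : Fin m → Carrier) → D (sum f) ≈ sum (λ j → D (f j))
    D-sum {zero}  f = D-0#
    D-sum {suc m} f = trans (D-+ _ _) (+-congˡ (D-sum (λ j → f (Fin.suc j))))

    D-scale : ∀ {a} → D a ≈ 0# → ∀ f → D (a * f) ≈ a * D f
    D-scale Da≈0 f = trans (leibniz _ f) (trans (+-congʳ (trans (*-congʳ Da≈0) (zeroˡ f))) (+-identityˡ _))

    -- The power rule, by the Leibniz rule on `u * u ^ k`. Without additive cancellation `D 1# ≈ 0#`
    -- does not follow from the Leibniz rule, so it is assumed.
    D-power : D 1# ≈ 0# → ∀ u k → D (u ^ suc k) ≈ suc k ℕ× (u ^ k * D u)
    D-power D1≈0 u zero = begin
      D (u * 1#)           ≈⟨ leibniz u 1# ⟩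
      D u * 1# + u * D 1#  ≈⟨ +-cong (*-comm _ _) (trans (*-congˡ D1≈0) (zeroʳ u)) ⟩
      1# * D u + 0#        ∎
    D-power D1≈0 u (suc k) = begin
      D (u * u ^ suc k)                                        ≈⟨ leibniz u (u ^ suc k) ⟩
      D u * u ^ suc k + u * D (u ^ suc k)                      ≈⟨ +-cong (*-comm _ _) (*-congˡ (D-power D1≈0 u k)) ⟩
      u ^ suc k * D u + u * (suc k ℕ× (u ^ k * D u))           ≈⟨ +-congˡ (×-comm-* (suc k) u _) ⟩
      u ^ suc k * D u + suc k ℕ× (u * (u ^ k * D u))           ≈⟨ +-congˡ (×-congʳ (suc k) (*-assoc u _ _)) ⟨
      u ^ suc k * D u + suc k ℕ× (u ^ suc k * D u)             ∎

    -- With a k = (-1)^k / (k + 1) and d k = (-1)^k this is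
    -- (1 + u) D(∑_{k<m} a k u^(k+1)) = (1 - (-u)^m) D u, written without subtraction.
    D-partialLog : D 1# ≈ 0# → ∀ (a d : ℕ → Carrier) u → (∀ k → D (a k) ≈ 0#) →
      (∀ k → suc k ℕ× a k ≈ d k) → d 0 ≈ 1# → (∀ k → d k + d (suc k) ≈ 0#) →
      ∀ m → (1# + u) * D (sum {m} (λ j → a (toℕ j) * u ^ suc (toℕ j))) + d m * (u ^ m * D u) ≈ D u
    D-partialLog D1≈0 a d u Da≈0 a≈d d₀ d₊ m = begin
      (1# + u) * D (sum {m} (λ j → f (toℕ j))) + G m
        ≈⟨ +-congʳ (*-congˡ (D-sum {m} (λ j → f (toℕ j)))) ⟩
      (1# + u) * sum {m} (λ j → D (f (toℕ j))) + G m
        ≈⟨ +-congʳ (*-distribˡ-sum {m} (1# + u) (λ j → D (f (toℕ j)))) ⟩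
      sum {m} (λ j → (1# + u) * D (f (toℕ j))) + G m
        ≈⟨ sum-telescope (λ k → (1# + u) * D (f k)) G step m ⟩
      d 0 * (1# * D u)
        ≈⟨ *-cong d₀ (*-identityˡ _) ⟩
      1# * D u
        ≈⟨ *-identityˡ _ ⟩
      D u ∎
      where
      f G : ℕ → Carrier
      f k = a k * u ^ suc k
      G k = d k * (u ^ k * D u)

      -- The factor `suc k` from the power rule cancels the denominator of `a k`.
      Df : ∀ k → D (f k) ≈ G k
      Df k = begin
        D (a k * u ^ suc k)               ≈⟨ D-scale (Da≈0 k) _ ⟩
        a k * D (u ^ suc k)               ≈⟨ *-congˡ (D-power D1≈0 u k) ⟩
        a k * (suc k ℕ× (u ^ k * D u))    ≈⟨ ×-comm-* (suc k) _ _ ⟩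
        suc k ℕ× (a k * (u ^ k * D u))    ≈⟨ ×-assoc-* (suc k) _ _ ⟨
        (suc k ℕ× a k) * (u ^ k * D u)    ≈⟨ *-congʳ (a≈d k) ⟩
        G k                               ∎

      step : ∀ k → (1# + u) * D (f k) + G (suc k) ≈ G k
      step k = begin
        (1# + u) * D (f k) + G (suc k)
          ≈⟨ +-congʳ (*-congˡ (Df k)) ⟩
        (1# + u) * (d k * (u ^ k * D u)) + d (suc k) * ((u * u ^ k) * D u)
          -- The term of degree `suc k` coming from the factor `u` is collected with `G (suc k)`;
          -- opposite signs `d k` and `d (suc k)` then cancel it.
          ≈⟨ solve 5 (λ u p e e′ v → (con 1 :+ u) :* (e :* (p :* v)) :+ e′ :* ((u :* p) :* v)
                        := e :* (p :* v) :+ (e :+ e′) :* ((u :* p) :* v))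
               refl u (u ^ k) (d k) (d (suc k)) (D u) ⟩
        G k + (d k + d (suc k)) * ((u * u ^ k) * D u)
          ≈⟨ +-congˡ (trans (*-congʳ (d₊ k)) (zeroˡ _)) ⟩
        G k + 0#
          ≈⟨ +-identityʳ _ ⟩
        G k ∎

-- Power series over a commutative semiring, as coefficient sequences

module PowerSeries {c ℓ} (R : CommutativeSemiring c ℓ) where

  open CommutativeSemiring R hiding (zero)
  open import Algebra.Definitions.RawMonoid +-rawMonoid using (sum)
  open import Algebra.Properties.Semiring.Mult semiring renaming (_×_ to _ℕ×_)
  open import Algebra.Properties.CommutativeMonoid.Mult +-commutativeMonoid using (×-distrib-+)
  open import Algebra.Properties.Semiring.Sum semiring using (*-distribˡ-sum; sum-cong-≋; ∑-distrib-+; sum-replicate-zero)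
  open import Algebra.Solver.Ring.NaturalCoefficients.Default R using (solve; _:=_; _:+_; _:*_; con)
  open Relation.Binary.Reasoning.Setoid setoid

  infix 4 _≋_
  infixl 6 _⊕_
  infixl 7 _⊛_

  _≋_ : (f g : ℕ → Carrier) → Set ℓ
  f ≋ g = ∀ n → f n ≈ g n

  -- The Cauchy product has exactly the shape of the coefficients of `_*ₚ_`, so `coeff (p *ₚ q)`
  -- unfolds to `coeff p ⊛ coeff q`.
  _⊕_ _⊛_ : (f g : ℕ → Carrier) → ℕ → Carrier
  (f ⊕ g) n = f n + g n
  (f ⊛ g) n = sum {suc n} (λ j → f (toℕ j) * g (n ∸ toℕ j))

  constant : Carrier → ℕ → Carrier
  constant a zero    = a
  constant a (suc _) = 0#

  tail : (ℕ → Carrier) → ℕ → Carrier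
  tail f n = f (suc n)

  sum-zero : ∀ {m} (f : Fin m → Carrier) → (∀ j → f j ≈ 0#) → sum f ≈ 0#
  sum-zero {m} f f≈0 = trans (sum-cong-≋ f≈0) (sum-replicate-zero m)

  ×-zero : ∀ n → n ℕ× 0# ≈ 0#
  ×-zero zero    = refl
  ×-zero (suc n) = trans (+-identityˡ _) (×-zero n)

  ×-sum : ∀ {m} n (f : Fin m → Carrier) → n ℕ× sum f ≈ sum (λ j → n ℕ× f j)
  ×-sum {zero}  n f = ×-zero n
  ×-sum {suc m} n f = trans (×-distrib-+ _ _ n) (+-congˡ (×-sum n (λ j → f (Fin.suc j))))

  -- Degree `n` of a product sees only degrees up to `n` of its factors; this allows a series to be
  -- exchanged for a truncation of it.
  ⊛-cong-≤ : ∀ {f f′ g g′} n → (∀ k → k ≤ n → f k ≈ f′ k) → (∀ k → k ≤ n → g k ≈ g′ k) →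
             (f ⊛ g) n ≈ (f′ ⊛ g′) n
  ⊛-cong-≤ n f≈ g≈ = sum-cong-≋ {suc n} (λ j → *-cong (f≈ (toℕ j) (toℕ≤pred[n] j)) (g≈ (n ∸ toℕ j) (ℕ.m∸n≤m n (toℕ j))))

  ⊛-cong : ∀ {f f′ g g′} → f ≋ f′ → g ≋ g′ → f ⊛ g ≋ f′ ⊛ g′
  ⊛-cong f≈ g≈ n = ⊛-cong-≤ n (λ k _ → f≈ k) (λ k _ → g≈ k)

  constant-⊛ : ∀ a f n → (constant a ⊛ f) n ≈ a * f n
  constant-⊛ a f n = trans (+-congˡ (sum-zero {n} _ (λ j → zeroˡ _))) (+-identityʳ _)

  ⊛-distribʳ : ∀ h f g → (f ⊕ g) ⊛ h ≋ f ⊛ h ⊕ g ⊛ h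
  ⊛-distribʳ h f g n = trans (sum-cong-≋ {suc n} (λ j → distribʳ (h (n ∸ toℕ j)) (f (toℕ j)) (g (toℕ j))))
    (∑-distrib-+ {suc n} (λ j → f (toℕ j) * h (n ∸ toℕ j)) (λ j → g (toℕ j) * h (n ∸ toℕ j)))

  ⊛-scale : ∀ a f g n → ((λ k → a * f k) ⊛ g) n ≈ a * (f ⊛ g) n
  ⊛-scale a f g n = trans (sum-cong-≋ {suc n} (λ j → *-assoc a (f (toℕ j)) (g (n ∸ toℕ j))))
    (sym (*-distribˡ-sum {suc n} a (λ j → f (toℕ j) * g (n ∸ toℕ j))))

  -- The mirror image of the definitional unfolding: the last summand is split off instead of the
  -- first.
  ⊛-suc : ∀ f g n → (f ⊛ g) (suc n) ≈ f (suc n) * g 0 + (f ⊛ tail g) n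
  ⊛-suc f g zero = solve 4 (λ a b c d → a :* b :+ (c :* d :+ con 0) := c :* d :+ (a :* b :+ con 0))
                     refl (f 0) (g 1) (f 1) (g 0)
  ⊛-suc f g (suc n) = begin
    f 0 * g (suc (suc n)) + (tail f ⊛ g) (suc n)
      ≈⟨ +-congˡ (⊛-suc (tail f) g n) ⟩
    f 0 * g (suc (suc n)) + (f (suc (suc n)) * g 0 + (tail f ⊛ tail g) n)
      ≈⟨ solve 3 (λ a b c → a :+ (b :+ c) := b :+ (a :+ c)) refl _ _ _ ⟩
    f (suc (suc n)) * g 0 + (f 0 * g (suc (suc n)) + (tail f ⊛ tail g) n) ∎

  -- The left side unfolds at its first summand and the right side at its last, by `⊛-suc`; the
  -- remaining products fall under the induction hypothesis.
  ⊛-comm : ∀ f g → f ⊛ g ≋ g ⊛ f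
  ⊛-comm f g zero    = +-congʳ (*-comm _ _)
  ⊛-comm f g (suc n) = trans (+-cong (*-comm _ _) (⊛-comm (tail f) g n)) (sym (⊛-suc g f n))

  -- Induction on the degree, through the tail of a product: `tail (f ⊛ g)` is `f 0` times `tail g`,
  -- plus `tail f ⊛ g`.
  ⊛-assoc : ∀ f g h → (f ⊛ g) ⊛ h ≋ f ⊛ (g ⊛ h)
  ⊛-assoc f g h zero = solve 3 (λ a b c → (a :* b :+ con 0) :* c :+ con 0 := a :* (b :* c :+ con 0) :+ con 0)
                         refl (f 0) (g 0) (h 0)
  ⊛-assoc f g h (suc n) = begin
    (f 0 * g 0 + 0#) * h (suc n) + (((λ k → f 0 * g (suc k)) ⊕ tail f ⊛ g) ⊛ h) n
      ≈⟨ +-congˡ (⊛-distribʳ h (λ k → f 0 * g (suc k)) (tail f ⊛ g) n) ⟩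
    (f 0 * g 0 + 0#) * h (suc n) + (((λ k → f 0 * g (suc k)) ⊛ h) n + ((tail f ⊛ g) ⊛ h) n)
      ≈⟨ +-congˡ (+-cong (⊛-scale (f 0) (tail g) h n) (⊛-assoc (tail f) g h n)) ⟩
    (f 0 * g 0 + 0#) * h (suc n) + (f 0 * (tail g ⊛ h) n + (tail f ⊛ (g ⊛ h)) n)
      ≈⟨ solve 5 (λ a b c s t → (a :* b :+ con 0) :* c :+ (a :* s :+ t) := a :* (b :* c :+ s) :+ t)
           refl (f 0) (g 0) (h (suc n)) ((tail g ⊛ h) n) ((tail f ⊛ (g ⊛ h)) n) ⟩
    f 0 * (g 0 * h (suc n) + (tail g ⊛ h) n) + (tail f ⊛ (g ⊛ h)) n ∎

  ⊛-identityˡ : ∀ f → constant 1# ⊛ f ≋ f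
  ⊛-identityˡ f n = trans (constant-⊛ 1# f n) (*-identityˡ _)

  commutativeSemiring : CommutativeSemiring c ℓ
  commutativeSemiring = record
    { Carrier = ℕ → Carrier
    ; _≈_ = _≋_
    ; _+_ = _⊕_
    ; _*_ = _⊛_
    ; 0# = λ _ → 0#
    ; 1# = constant 1#
    ; isCommutativeSemiring = isCommutativeSemiringˡ record
      { +-isCommutativeMonoid = record
        { isMonoid = record
          { isSemigroup = record
            { isMagma = record
              { isEquivalence = ≋-isEquivalence
              ; ∙-cong = λ f≈ g≈ n → +-cong (f≈ n) (g≈ n)
              }
            ; assoc = λ f g h n → +-assoc _ _ _
            }
          ; identity = (λ f n → +-identityˡ _) , (λ f n → +-identityʳ _)
          }
        ; comm = λ f g n → +-comm _ _
        }
      ; *-isCommutativeMonoid = record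
        { isMonoid = record
          { isSemigroup = record
            { isMagma = record { isEquivalence = ≋-isEquivalence ; ∙-cong = ⊛-cong }
            ; assoc = ⊛-assoc
            }
          ; identity = ⊛-identityˡ , λ f n → trans (⊛-comm f (constant 1#) n) (⊛-identityˡ f n)
          }
        ; comm = ⊛-comm
        }
      ; distribʳ = ⊛-distribʳ
      ; zeroˡ = λ f n → sum-zero {suc n} _ (λ j → zeroˡ (f (n ∸ toℕ j)))
      }
    }
    where
    ≋-isEquivalence : IsEquivalence _≋_
    ≋-isEquivalence = record
      { refl = λ _ → refl
      ; sym = λ f≈ n → sym (f≈ n)
      ; trans = λ f≈ g≈ n → trans (f≈ n) (g≈ n)
      }

  private module PS = CommutativeSemiring commutativeSemiring
  open import Algebra.Definitions.RawSemiring PS.rawSemiring using () renaming (_^_ to _^ₚₛ_; _×_ to _×ₚₛ_)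
  open import Algebra.Definitions.RawMonoid PS.+-rawMonoid using () renaming (sum to sumₚₛ)

  sum-apply : ∀ {m} (f : Fin m → ℕ → Carrier) n → sumₚₛ f n ≈ sum (λ j → f j n)
  sum-apply {zero}  f n = refl
  sum-apply {suc m} f n = +-congˡ (sum-apply (λ j → f (Fin.suc j)) n)

  ×-apply : ∀ m f n → (m ×ₚₛ f) n ≈ m ℕ× f n
  ×-apply zero    f n = refl
  ×-apply (suc m) f n = +-congˡ (×-apply m f n)

  ×-constant : ∀ m a → m ×ₚₛ constant a ≋ constant (m ℕ× a)
  ×-constant m a zero    = ×-apply m (constant a) zero
  ×-constant m a (suc n) = trans (×-apply m (constant a) (suc n)) (×-zero m)

  constant-cong : ∀ {a b} → a ≈ b → constant a ≋ constant b
  constant-cong a≈b zero    = a≈b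
  constant-cong a≈b (suc _) = refl

  constant-vanish : ∀ {a} → a ≈ 0# → constant a ≋ PS.0#
  constant-vanish a≈0 zero    = a≈0
  constant-vanish a≈0 (suc _) = refl

  constant-+ : ∀ a b → constant a ⊕ constant b ≋ constant (a + b)
  constant-+ a b zero    = refl
  constant-+ a b (suc _) = +-identityˡ 0#

  -- The Euler derivation and the logarithm of a power series

  θ : (ℕ → Carrier) → ℕ → Carrier
  θ f n = n ℕ× f n

  θ-constant : ∀ a → θ (constant a) ≋ PS.0#
  θ-constant a zero    = refl
  θ-constant a (suc n) = ×-zero (suc n)

  open Derivations commutativeSemiring using (IsDerivation)

  θ-isDerivation : IsDerivation θ
  θ-isDerivation = record
    { D-cong  = λ f≈ n → ×-congʳ n (f≈ n)
    ; D-0#    = ×-zero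
    ; D-+     = λ f g n → ×-distrib-+ _ _ n
    ; leibniz = leibniz
    }
    where
    leibniz : ∀ f g → θ (f ⊛ g) ≋ θ f ⊛ g ⊕ f ⊛ θ g
    leibniz f g n = begin
      n ℕ× (f ⊛ g) n
        ≈⟨ ×-sum {suc n} n (λ j → f (toℕ j) * g (n ∸ toℕ j)) ⟩
      sum {suc n} (λ j → n ℕ× (f (toℕ j) * g (n ∸ toℕ j)))
        ≈⟨ sum-cong-≋ {suc n} (λ j → split (toℕ j) (toℕ≤pred[n] j)) ⟩
      sum {suc n} (λ j → θ f (toℕ j) * g (n ∸ toℕ j) + f (toℕ j) * θ g (n ∸ toℕ j))
        ≈⟨ ∑-distrib-+ {suc n} (λ j → θ f (toℕ j) * g (n ∸ toℕ j)) (λ j → f (toℕ j) * θ g (n ∸ toℕ j)) ⟩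
      (θ f ⊛ g) n + (f ⊛ θ g) n ∎
      where
      -- The weight `n` is distributed as `k` on `f` and `n ∸ k` on `g`; the bound `k ≤ n` keeps the
      -- subtraction from truncating.
      split : ∀ k → k ≤ n → n ℕ× (f k * g (n ∸ k)) ≈ θ f k * g (n ∸ k) + f k * θ g (n ∸ k)
      split k k≤n = begin
        n ℕ× (f k * g (n ∸ k))                                ≈⟨ ×-congˡ (≡.sym (ℕ.m+[n∸m]≡n k≤n)) ⟩
        (k ℕ.+ (n ∸ k)) ℕ× (f k * g (n ∸ k))                  ≈⟨ ×-homo-+ _ k (n ∸ k) ⟩
        k ℕ× (f k * g (n ∸ k)) + (n ∸ k) ℕ× (f k * g (n ∸ k)) ≈⟨ +-cong (×-assoc-* k _ _) (×-comm-* (n ∸ k) _ _) ⟨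
        θ f k * g (n ∸ k) + f k * θ g (n ∸ k)                 ∎

  -- A factor without constant term raises the order by one: in `f k * g (n ∸ k)` either `k` is 0 or
  -- `n ∸ k` is below `n`.
  ⊛-vanish : ∀ f g n → f 0 ≈ 0# → (∀ k → k < n → g k ≈ 0#) → (f ⊛ g) n ≈ 0#
  ⊛-vanish f g n f₀ g≈0 = sum-zero {suc n} _ λ j → vanish (toℕ j) (toℕ≤pred[n] j)
    where
    vanish : ∀ k → k ≤ n → f k * g (n ∸ k) ≈ 0#
    vanish zero    _   = trans (*-congʳ f₀) (zeroˡ _)
    vanish (suc k) k<n = trans (*-congˡ (g≈0 (n ∸ suc k) (ℕ.∸-monoʳ-< {n} (s≤s z≤n) k<n))) (zeroʳ _)

  ^-vanish : ∀ u → u 0 ≈ 0# → ∀ m n → n < m → (u ^ₚₛ m) n ≈ 0#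
  ^-vanish u u₀ (suc m) n (s≤s n≤m) =
    ⊛-vanish u (u ^ₚₛ m) n u₀ (λ k k<n → ^-vanish u u₀ m k (ℕ.<-≤-trans k<n n≤m))

  -- L need only agree up to degree n with one partial sum of log (1 + u) of length m ≥ n.
  θ-log : ∀ (a d : ℕ → Carrier) u → (∀ k → suc k ℕ× a k ≈ d k) → d 0 ≈ 1# → (∀ k → d k + d (suc k) ≈ 0#) →
    u 0 ≈ 0# → ∀ L n m → n ≤ m →
    (∀ k → k ≤ n → sum {m} (λ j → a (toℕ j) * (u ^ₚₛ suc (toℕ j)) k) ≈ L k) →
    (θ L ⊛ (constant 1# ⊕ u)) n ≈ n ℕ× u n
  θ-log a d u a≈d d₀ d₊ u₀ L n m n≤m Λ≈L = begin
    (θ L ⊛ V) n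
      ≈⟨ ⊛-cong-≤ {θ L} {θ Λ} {V} {V} n (λ k k≤n → ×-congʳ k (trans (sym (Λ≈L k k≤n)) (sym (Λ-apply k)))) (λ k _ → refl) ⟩
    (θ Λ ⊛ V) n
      ≈⟨ ⊛-comm (θ Λ) V n ⟩
    (V ⊛ θ Λ) n
      ≈⟨ +-identityʳ _ ⟨
    (V ⊛ θ Λ) n + 0#
      -- The error term of `D-partialLog` is inserted. It vanishes in degree `n`: `u` to the power
      -- `m` has no terms below degree `m`, and `θ u` has no constant term, so `n ≤ m` suffices.
      ≈⟨ +-congˡ remainder ⟨
    (V ⊛ θ Λ) n + (constant (d m) ⊛ (u ^ₚₛ m ⊛ θ u)) n
      ≈⟨ D-partialLog θ-isDerivation (θ-constant 1#) (λ k → constant (a k)) (λ k → constant (d k)) u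
           (λ k → θ-constant (a k))
           (λ k → PS.trans (×-constant (suc k) (a k)) (constant-cong (a≈d k)))
           (constant-cong d₀)
           (λ k → PS.trans (constant-+ (d k) (d (suc k))) (constant-vanish (d₊ k)))
           m n ⟩
    n ℕ× u n ∎
    where
    open Derivations commutativeSemiring using (D-partialLog)
    V Λ : ℕ → Carrier
    V = constant 1# ⊕ u
    Λ = sumₚₛ {m} (λ j → constant (a (toℕ j)) ⊛ u ^ₚₛ suc (toℕ j))

    Λ-apply : ∀ k → Λ k ≈ sum {m} (λ j → a (toℕ j) * (u ^ₚₛ suc (toℕ j)) k)
    Λ-apply k = trans (sum-apply {m} (λ j → constant (a (toℕ j)) ⊛ u ^ₚₛ suc (toℕ j)) k)
      (sum-cong-≋ {m} (λ j → constant-⊛ (a (toℕ j)) (u ^ₚₛ suc (toℕ j)) k))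

    remainder : (constant (d m) ⊛ (u ^ₚₛ m ⊛ θ u)) n ≈ 0#
    remainder = begin
      (constant (d m) ⊛ (u ^ₚₛ m ⊛ θ u)) n  ≈⟨ constant-⊛ (d m) (u ^ₚₛ m ⊛ θ u) n ⟩
      d m * (u ^ₚₛ m ⊛ θ u) n               ≈⟨ *-congˡ (⊛-comm (u ^ₚₛ m) (θ u) n) ⟩
      d m * (θ u ⊛ u ^ₚₛ m) n               ≈⟨ *-congˡ (⊛-vanish (θ u) (u ^ₚₛ m) n refl
                                                 (λ k k<n → ^-vanish u u₀ m k (ℕ.<-≤-trans k<n n≤m))) ⟩
      d m * 0#                              ≈⟨ zeroʳ _ ⟩
      0#                                    ∎

-- `FormalSeries` takes `recip` as a bare function. This law makes `R` an algebra over the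
-- rationals, which is all that the argument uses of ℂ.
IsReciprocal : ∀ {c ℓ} (R : CommutativeRing c ℓ) →
               ((n : ℕ) .{{_ : NonZero n}} → CommutativeRing.Carrier R) → Set ℓ
IsReciprocal R recip = ∀ n .{{_ : NonZero n}} → FormalSeries.ι R recip n * recip n ≈ 1#
  where
  open CommutativeRing R

-- The equation for V over a commutative ring with reciprocals

module LogEquation {c ℓ} (R : CommutativeRing c ℓ)
                   (recip : (n : ℕ) .{{_ : NonZero n}} → CommutativeRing.Carrier R)
                   (recip-inverse : IsReciprocal R recip) where

  open CommutativeRing R hiding (zero; _-_)
  open FormalSeries R recip
  open import Algebra.Properties.Ring ring using (-‿involutive; -1*x≈-x; -0#≈0#)
  open import Algebra.Definitions.RawMonoid +-rawMonoid using (sum)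
  open import Algebra.Definitions.RawMonoid +ₚ-rawMonoid using () renaming (sum to sumₚ)
  open import Algebra.Definitions.RawMonoid +ₛ-rawMonoid using () renaming (sum to sumₛ)
  open import Algebra.Properties.Semiring.Mult semiring using (×-assoc-*; ×-congʳ) renaming (_×_ to _ℕ×_)
  open import Algebra.Properties.CommutativeMonoid.Mult +-commutativeMonoid using (×-distrib-+)
  open import Algebra.Properties.Semiring.Sum semiring using (sum-cong-≋; ∑-distrib-+)
  open import Algebra.Definitions.RawSemiring (RawRing.rawSemiring rawRing) using (_^_)
  open import Algebra.Solver.Ring.NaturalCoefficients.Default commutativeSemiring using (solve; _:=_; _:+_; _:*_; con)
  open Relation.Binary.Reasoning.Setoid setoid

  private
    -- The construction is iterated: `S` consists of series in y over `R`, and `T` of series in 1/x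
    -- with coefficients in `S`. `SM` holds the laws of natural multiples in `S`.
    module S = PowerSeries commutativeSemiring
    module S′ = CommutativeSemiring S.commutativeSemiring
    module SM = Algebra.Properties.Semiring.Mult S′.semiring
    module T = PowerSeries S.commutativeSemiring
    module T′ = CommutativeSemiring T.commutativeSemiring
    module TR = Algebra.Definitions.RawSemiring T′.rawSemiring

  -- Embedding of A into the iterated power series, forgetting degree bounds

  ⟦_⟧ : Series → ℕ → ℕ → Carrier
  ⟦ a ⟧ n = coeff (term a n)

  coeff-const : ∀ r → coeff (const r) S.≋ S.constant r
  coeff-const r zero    = refl
  coeff-const r (suc i) = refl

  coeff-0ₚ : ∀ i → coeff 0ₚ i ≈ 0#
  coeff-0ₚ zero    = refl
  coeff-0ₚ (suc i) = refl

  coeff-sumₚ : ∀ {m} (f : Fin m → Poly) i → coeff (sumₚ f) i ≈ sum (λ j → coeff (f j) i)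
  coeff-sumₚ {zero}  f i = coeff-0ₚ i
  coeff-sumₚ {suc m} f i = +-congˡ (coeff-sumₚ (λ j → f (Fin.suc j)) i)

  coeff-sumₛ : ∀ {m} (f : Fin m → Series) n i → ⟦ sumₛ f ⟧ n i ≈ sum (λ j → ⟦ f j ⟧ n i)
  coeff-sumₛ {zero}  f n i = coeff-0ₚ i
  coeff-sumₛ {suc m} f n i = +-congˡ (coeff-sumₛ (λ j → f (Fin.suc j)) n i)

  ⟦1ₛ⟧ : ⟦ 1ₛ ⟧ T.≋ T.constant (S.constant 1#)
  ⟦1ₛ⟧ zero    i = coeff-const 1# i
  ⟦1ₛ⟧ (suc n) i = coeff-0ₚ i

  ⟦*ₛ⟧ : ∀ a b → ⟦ a *ₛ b ⟧ T.≋ ⟦ a ⟧ T.⊛ ⟦ b ⟧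
  ⟦*ₛ⟧ a b n i = trans (coeff-sumₚ {suc n} (λ j → term a (toℕ j) *ₚ term b (n ∸ toℕ j)) i)
    (sym (S.sum-apply {suc n} (λ j → ⟦ a ⟧ (toℕ j) S.⊛ ⟦ b ⟧ (n ∸ toℕ j)) i))

  ⟦^ₛ⟧ : ∀ a k → ⟦ a ^ₛ k ⟧ T.≋ ⟦ a ⟧ TR.^ k
  ⟦^ₛ⟧ a zero    = ⟦1ₛ⟧
  ⟦^ₛ⟧ a (suc k) = T′.trans {⟦ a ^ₛ suc k ⟧} {⟦ a ⟧ T.⊛ ⟦ a ^ₛ k ⟧} {⟦ a ⟧ TR.^ suc k}
    (⟦*ₛ⟧ a (a ^ₛ k)) (T.⊛-cong {⟦ a ⟧} {⟦ a ⟧} {⟦ a ^ₛ k ⟧} {⟦ a ⟧ TR.^ k} (λ n i → refl) (⟦^ₛ⟧ a k))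

  -- The head of `x⁻¹` is zero and its tail is the unit series, so multiplication by it is a shift
  -- of degree.
  ⟦x⁻¹*ₛ⟧-suc : ∀ a n i → ⟦ x⁻¹ *ₛ a ⟧ (suc n) i ≈ ⟦ a ⟧ n i
  ⟦x⁻¹*ₛ⟧-suc a n i = begin
    ⟦ x⁻¹ *ₛ a ⟧ (suc n) i
      ≈⟨ ⟦*ₛ⟧ x⁻¹ a (suc n) i ⟩
    (coeff 0ₚ S.⊛ ⟦ a ⟧ (suc n)) i + (T.tail ⟦ x⁻¹ ⟧ T.⊛ ⟦ a ⟧) n i
      ≈⟨ +-cong (S.⊛-cong {coeff 0ₚ} {S′.0#} {⟦ a ⟧ (suc n)} coeff-0ₚ (λ _ → refl) i)
                (T.⊛-cong {T.tail ⟦ x⁻¹ ⟧} {T′.1#} {⟦ a ⟧} tail-x⁻¹ (λ _ _ → refl) n i) ⟩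
    (S′.0# S.⊛ ⟦ a ⟧ (suc n)) i + (T′.1# T.⊛ ⟦ a ⟧) n i
      ≈⟨ +-cong (S′.zeroˡ (⟦ a ⟧ (suc n)) i) (T.⊛-identityˡ ⟦ a ⟧ n i) ⟩
    0# + ⟦ a ⟧ n i
      ≈⟨ +-identityˡ _ ⟩
    ⟦ a ⟧ n i ∎
    where
    tail-x⁻¹ : T.tail ⟦ x⁻¹ ⟧ T.≋ T′.1#
    tail-x⁻¹ zero    i = coeff-const 1# i
    tail-x⁻¹ (suc n) i = coeff-0ₚ i

  ι* : ∀ n x → ι n * x ≈ n ℕ× x
  ι* n x = trans (×-assoc-* n 1# x) (×-congʳ n (*-identityˡ x))

  recip-× : ∀ n .{{_ : NonZero n}} x → recip n * (n ℕ× x) ≈ x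
  recip-× n x = begin
    recip n * (n ℕ× x)   ≈⟨ *-congˡ (ι* n x) ⟨
    recip n * (ι n * x)  ≈⟨ solve 3 (λ r e x → r :* (e :* x) := (e :* r) :* x) refl (recip n) (ι n) x ⟩
    (ι n * recip n) * x  ≈⟨ *-congʳ (recip-inverse n) ⟩
    1# * x               ≈⟨ *-identityˡ x ⟩
    x                    ∎

  -- The coefficients of log V

  module _ (V : Series) (V₀ : term V 0 ≈ₚ 1ₚ) where

    private
      v L u : ℕ → ℕ → Carrier
      v = ⟦ V ⟧
      L = ⟦ log V V₀ ⟧
      u = ⟦ V -ₛ 1ₛ ⟧

    1+u≈v : T′.1# T.⊕ u T.≋ v
    1+u≈v n i = begin
      T′.1# n i + (v n i + - ⟦ 1ₛ ⟧ n i)   ≈⟨ +-congʳ (⟦1ₛ⟧ n i) ⟨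
      ⟦ 1ₛ ⟧ n i + (v n i + - ⟦ 1ₛ ⟧ n i)  ≈⟨ solve 3 (λ a b c → a :+ (b :+ c) := b :+ (a :+ c)) refl _ _ _ ⟩
      v n i + (⟦ 1ₛ ⟧ n i + - ⟦ 1ₛ ⟧ n i)  ≈⟨ +-congˡ (-‿inverseʳ _) ⟩
      v n i + 0#                           ≈⟨ +-identityʳ _ ⟩
      v n i                                ∎

    u₀ : ∀ i → u 0 i ≈ 0#
    u₀ i = trans (+-congʳ (V₀ i)) (-‿inverseʳ _)

    u-suc : ∀ n i → u (suc n) i ≈ v (suc n) i
    u-suc n i = trans (+-congˡ (trans (-‿cong (coeff-0ₚ i)) -0#≈0#)) (+-identityʳ _)

    private
      -- Indices are shifted by one: `sign k` belongs to the summand number `suc k` of the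
      -- logarithm. The unsimplified exponent agrees definitionally with the one in `logSummand`.
      sign : ℕ → Carrier
      sign k = (- 1#) ^ (suc k ℕ.+ 1)

      logCoefficient : ℕ → Carrier
      logCoefficient k = sign k * recip (suc k)

    sign-alternates : ∀ k → sign k + sign (suc k) ≈ 0#
    sign-alternates k = trans (+-congˡ (-1*x≈-x (sign k))) (-‿inverseʳ _)

    sign-0 : sign 0 ≈ 1#
    sign-0 = begin
      (- 1#) * ((- 1#) * 1#)  ≈⟨ *-congˡ (*-identityʳ _) ⟩
      (- 1#) * (- 1#)         ≈⟨ -1*x≈-x _ ⟩
      - (- 1#)                ≈⟨ -‿involutive 1# ⟩
      1#                      ∎

    ×-logCoefficient : ∀ k → suc k ℕ× logCoefficient k ≈ sign k
    ×-logCoefficient k = begin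
      suc k ℕ× (sign k * recip (suc k))        ≈⟨ ι* (suc k) _ ⟨
      ι (suc k) * (sign k * recip (suc k))     ≈⟨ solve 3 (λ e s r → e :* (s :* r) := s :* (e :* r)) refl _ _ _ ⟩
      sign k * (ι (suc k) * recip (suc k))     ≈⟨ *-congˡ (recip-inverse (suc k)) ⟩
      sign k * 1#                              ≈⟨ *-identityʳ _ ⟩
      sign k                                   ∎

    -- `T.θ-log` applied to `u = V - 1`. Only positive degrees are considered, because there `u` and
    -- `v` have the same coefficients.
    θ-log-V : ∀ n → (T.θ L T.⊛ v) (suc n) S.≋ (λ i → suc n ℕ× v (suc n) i)
    θ-log-V n′ i = begin
      (T.θ L T.⊛ v) n i
        ≈⟨ T.⊛-cong {T.θ L} {T.θ L} {v} {T′.1# T.⊕ u} (λ _ _ → refl) (λ k j → sym (1+u≈v k j)) n i ⟩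
      (T.θ L T.⊛ (T′.1# T.⊕ u)) n i
        ≈⟨ T.θ-log (λ k → S.constant (logCoefficient k)) (λ k → S.constant (sign k)) u
             (λ k → S′.trans {suc k SM.× S.constant (logCoefficient k)}
                      (S.×-constant (suc k) (logCoefficient k)) (S.constant-cong (×-logCoefficient k)))
             (S.constant-cong sign-0)
             (λ k → S′.trans {S.constant (sign k) S.⊕ S.constant (sign (suc k))}
                      (S.constant-+ (sign k) (sign (suc k))) (S.constant-vanish (sign-alternates k)))
             u₀ L n m (ℕ.m≤n⊔m K n) Λ≈L i ⟩
      (n SM.× u n) i
        ≈⟨ S.×-apply n (u n) i ⟩
      n ℕ× u n i
        ≈⟨ ×-congʳ n (u-suc n′ i) ⟩
      n ℕ× v n i ∎
      where
      n = suc n′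
      K = proj₁ (log-converges V V₀ n)
      -- From `K` on, the partial sums agree with `log V` up to degree `n`; taking the maximum with
      -- `n` also gives the bound `n ≤ m` that `T.θ-log` requires.
      m = K ⊔ n
      U = V -ₛ 1ₛ

      open import Algebra.Definitions.RawMonoid S′.+-rawMonoid using () renaming (sum to sumPS)

      Λ≈L : ∀ k → k ≤ n → sumPS {m} (λ j → S.constant (logCoefficient (toℕ j)) S.⊛ (u TR.^ suc (toℕ j)) k) S.≋ L k
      Λ≈L k k≤n i = begin
        sumPS {m} (λ j → S.constant (logCoefficient (toℕ j)) S.⊛ (u TR.^ suc (toℕ j)) k) i
          ≈⟨ S.sum-apply {m} (λ j → S.constant (logCoefficient (toℕ j)) S.⊛ (u TR.^ suc (toℕ j)) k) i ⟩
        sum {m} (λ j → (S.constant (logCoefficient (toℕ j)) S.⊛ (u TR.^ suc (toℕ j)) k) i)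
          ≈⟨ sum-cong-≋ {m} (λ j → trans (S.constant-⊛ (logCoefficient (toℕ j)) ((u TR.^ suc (toℕ j)) k) i)
                                         (*-congˡ (sym (⟦^ₛ⟧ U (suc (toℕ j)) k i)))) ⟩
        sum {m} (λ j → ⟦ logSummand U (suc (toℕ j)) ⟧ k i)
          ≈⟨ coeff-sumₛ {m} (λ j → logSummand U (suc (toℕ j))) k i ⟨
        ⟦ ∑ₛ.∑[1⋯ m ] logSummand U ⟧ k i
          ≈⟨ proj₂ (log-converges V V₀ n) m (ℕ.m≤m⊔n K n) k k≤n i ⟩
        L k i ∎

    -- Both end terms of the Cauchy product in `θ-log-V` are evaluated: the last contains `v 0`,
    -- which is 1, and the first contains `T.θ L 0`, which is 0.
    log-recurrence : ∀ n i →
      suc n ℕ× L (suc n) i + sum {n} (λ j → (T.θ L (suc (toℕ j)) S.⊛ v (suc (n ∸ suc (toℕ j)))) i)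
      ≈ suc n ℕ× v (suc n) i
    log-recurrence n i = begin
      suc n ℕ× L (suc n) i + Σ
        ≈⟨ +-cong (sym first) (sym (+-identityˡ _)) ⟩
      (T.θ L (suc n) S.⊛ v 0) i + (0# + Σ)
        ≈⟨ +-congˡ (+-cong (sym (S′.zeroˡ (v (suc n)) i)) (sym (S.sum-apply {n} summand i))) ⟩
      (T.θ L (suc n) S.⊛ v 0) i + (T.θ L T.⊛ T.tail v) n i
        ≈⟨ T.⊛-suc (T.θ L) v n i ⟨
      (T.θ L T.⊛ v) (suc n) i
        ≈⟨ θ-log-V n i ⟩
      suc n ℕ× v (suc n) i ∎
      where
      summand : Fin n → ℕ → Carrier
      summand j = T.θ L (suc (toℕ j)) S.⊛ v (suc (n ∸ suc (toℕ j)))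
      Σ = sum {n} (λ j → summand j i)
      first : (T.θ L (suc n) S.⊛ v 0) i ≈ suc n ℕ× L (suc n) i
      first = begin
        (T.θ L (suc n) S.⊛ v 0) i
          ≈⟨ S.⊛-cong {T.θ L (suc n)} {T.θ L (suc n)} {v 0} {S′.1#} (λ _ → refl)
               (λ j → trans (V₀ j) (coeff-const 1# j)) i ⟩
        (T.θ L (suc n) S.⊛ S′.1#) i
          ≈⟨ S′.*-identityʳ (T.θ L (suc n)) i ⟩
        T.θ L (suc n) i
          ≈⟨ S.×-apply (suc n) (L (suc n)) i ⟩
        suc n ℕ× L (suc n) i ∎

    -- From the functional equation to the recurrence for P

    module _ (V-solves : V ≈ₛ 1ₛ +ₛ y/x -ₛ x⁻¹ *ₛ V -ₛ ∂x V -ₛ x⁻¹ *ₛ ∂y V +ₛ x⁻¹ *ₛ log V V₀) where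

      private
        P : ℕ → Poly
        P n = term V (suc n)

      -- In degree `suc n` the constant `1ₛ` disappears and each factor 1/x lowers the degree by
      -- one. So does `∂x`, whose own minus sign cancels the one in the equation.
      shifted-equation : ∀ n i → v (suc n) i ≈
        (⟦ y/x ⟧ (suc n) i + - v n i + ι n * v n i + - ⟦ ∂y V ⟧ n i) + L n i
      shifted-equation n i = trans (V-solves (suc n) i)
        (+-cong (+-cong (+-cong (+-cong
            (trans (+-congʳ (coeff-0ₚ i)) (+-identityˡ _))
            (-‿cong (⟦x⁻¹*ₛ⟧-suc V n i)))
          (-‿involutive _))
          (-‿cong (⟦x⁻¹*ₛ⟧-suc (∂y V) n i)))
          (⟦x⁻¹*ₛ⟧-suc (log V V₀) n i))

      -- Degree 1: both derivatives contribute nothing, and `log V` has no constant term because its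
      -- sum in degree 0 is empty.
      P-zero : P 0 ≈ₚ Y -ₚ 1ₚ
      P-zero i = begin
        v 1 i
          ≈⟨ shifted-equation 0 i ⟩
        coeff Y i + - v 0 i + 0# * v 0 i + - coeff 0ₚ i + coeff 0ₚ i
          ≈⟨ +-cong (+-cong (+-cong (+-congˡ (-‿cong (V₀ i))) (zeroˡ _)) (trans (-‿cong (coeff-0ₚ i)) -0#≈0#)) (coeff-0ₚ i) ⟩
        coeff Y i + - coeff 1ₚ i + 0# + 0# + 0#
          ≈⟨ solve 1 (λ a → a :+ con 0 :+ con 0 :+ con 0 := a) refl _ ⟩
        coeff Y i + - coeff 1ₚ i ∎

      -- The summand -V/x removes one of the `suc k` copies of `P k` produced by the x-derivative,
      -- which leaves the factor `ι k`.
      P-suc : ∀ k i → coeff (P (suc k)) i ≈ (ι k * coeff (P k) i + - coeff (P k ′) i) + L (suc k) i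
      P-suc k i = begin
        v (suc (suc k)) i
          ≈⟨ shifted-equation (suc k) i ⟩
        coeff 0ₚ i + - p + (1# + ι k) * p + - p′ + l
          ≈⟨ +-congʳ (+-congʳ (+-congʳ (+-congʳ (coeff-0ₚ i)))) ⟩
        0# + - p + (1# + ι k) * p + - p′ + l
          ≈⟨ solve 5 (λ p -p e -p′ l → con 0 :+ -p :+ (con 1 :+ e) :* p :+ -p′ :+ l
                        := (p :+ -p) :+ (e :* p :+ -p′ :+ l)) refl p (- p) (ι k) (- p′) l ⟩
        (p + - p) + (ι k * p + - p′ + l)
          ≈⟨ trans (+-congʳ (-‿inverseʳ p)) (+-identityˡ _) ⟩
        ι k * p + - p′ + l ∎
        where
        p = coeff (P k) i
        p′ = coeff (P k ′) i
        l = L (suc k) i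

      private
        -- The braces of the recurrence. For positive `k` this is minus the coefficient of `log V`
        -- in degree `k`, by `M+L≈0`.
        M : ℕ → Poly
        M k = ι (k ∸ 1) · P (k ∸ 1) -ₚ P k -ₚ P (k ∸ 1) ′

      M+L≈0 : ∀ k i → coeff (M (suc k)) i + L (suc k) i ≈ 0#
      M+L≈0 k i = begin
        (e + - q + - p′) + l    ≈⟨ solve 4 (λ e -q -p′ l → (e :+ -q :+ -p′) :+ l := (e :+ -p′ :+ l) :+ -q) refl e (- q) (- p′) l ⟩
        (e + - p′ + l) + - q    ≈⟨ +-congʳ (P-suc k i) ⟨
        q + - q                 ≈⟨ -‿inverseʳ q ⟩
        0#                      ∎
        where
        e = ι k * coeff (P k) i
        q = coeff (P (suc k)) i
        p′ = coeff (P k ′) i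
        l = L (suc k) i

      recurrence : (n : ℕ) .{{_ : NonZero n}} →
        P n ≈ₚ ι n · P (n ∸ 1) -ₚ P (n ∸ 1) ′
               +ₚ recip n · ∑[1⋯ n ∸ 1 ] (λ k →
                    ι k · ((ι (k ∸ 1) · P (k ∸ 1) -ₚ P k -ₚ P (k ∸ 1) ′) *ₚ P (n ∸ k ∸ 1)))
      recurrence (suc n) i = begin
        coeff (P (suc n)) i
          ≈⟨ P-suc n i ⟩
        (ι n * p + - p′) + L (suc n) i
          ≈⟨ +-congˡ L≈ ⟩
        (ι n * p + - p′) + (p + recip (suc n) * Q)
          -- The copy of `p` contributed by the logarithm raises the factor `ι n` to `ι (suc n)`.
          ≈⟨ solve 4 (λ e p -p′ q → (e :* p :+ -p′) :+ (p :+ q) := ((con 1 :+ e) :* p :+ -p′) :+ q)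
               refl (ι n) p (- p′) (recip (suc n) * Q) ⟩
        (ι (suc n) * p + - p′) + recip (suc n) * Q ∎
        where
        p = coeff (P n) i
        p′ = coeff (P n ′) i

        Q-summand : Fin n → Poly
        Q-summand j = ι (suc (toℕ j)) · (M (suc (toℕ j)) *ₚ P (n ∸ toℕ j ∸ 1))

        Q C : Carrier
        Q = coeff (sumₚ Q-summand) i
        C = sum {n} (λ j → (T.θ L (suc (toℕ j)) S.⊛ v (suc (n ∸ suc (toℕ j)))) i)

        -- As `M (suc k)` is minus `L (suc k)`, each summand of the recurrence is minus the matching
        -- summand of `log-recurrence`.
        cancel : ∀ k p → ι (suc k) * (coeff (M (suc k)) S.⊛ p) i + (T.θ L (suc k) S.⊛ p) i ≈ 0#
        cancel k p = begin
          ι (suc k) * (coeff (M (suc k)) S.⊛ p) i + (T.θ L (suc k) S.⊛ p) i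
            ≈⟨ +-cong (ι* (suc k) _) (trans (SM.×-assoc-* (suc k) (L (suc k)) p i) (S.×-apply (suc k) (L (suc k) S.⊛ p) i)) ⟩
          suc k ℕ× (coeff (M (suc k)) S.⊛ p) i + suc k ℕ× (L (suc k) S.⊛ p) i
            ≈⟨ ×-distrib-+ _ _ (suc k) ⟨
          suc k ℕ× ((coeff (M (suc k)) S.⊛ p) i + (L (suc k) S.⊛ p) i)
            ≈⟨ ×-congʳ (suc k) (S.⊛-distribʳ p (coeff (M (suc k))) (L (suc k)) i) ⟨
          suc k ℕ× ((coeff (M (suc k)) S.⊕ L (suc k)) S.⊛ p) i
            ≈⟨ ×-congʳ (suc k) (S.⊛-cong {coeff (M (suc k)) S.⊕ L (suc k)} {S′.0#} {p} {p} (M+L≈0 k) (λ _ → refl) i) ⟩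
          suc k ℕ× (S′.0# S.⊛ p) i
            ≈⟨ ×-congʳ (suc k) (S′.zeroˡ p i) ⟩
          suc k ℕ× 0#
            ≈⟨ S.×-zero (suc k) ⟩
          0# ∎

        Q+C≈0 : Q + C ≈ 0#
        Q+C≈0 = begin
          Q + C
            ≈⟨ +-congʳ (coeff-sumₚ Q-summand i) ⟩
          sum (λ j → coeff (Q-summand j) i) + C
            ≈⟨ ∑-distrib-+ {n} (λ j → coeff (Q-summand j) i)
                 (λ j → (T.θ L (suc (toℕ j)) S.⊛ v (suc (n ∸ suc (toℕ j)))) i) ⟨
          sum {n} (λ j → coeff (Q-summand j) i + (T.θ L (suc (toℕ j)) S.⊛ v (suc (n ∸ suc (toℕ j)))) i)
            ≈⟨ S.sum-zero {n} _ (λ j → trans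
                 -- The index `n ∸ suc j` of `log-recurrence` is rewritten as `n ∸ j ∸ 1`, the form
                 -- to which the index in the theorem computes.
                 (+-congˡ (reflexive (≡.cong (λ m → (T.θ L (suc (toℕ j)) S.⊛ coeff (P m)) i)
                                             (≡.sym (ℕ.pred[m∸n]≡m∸[1+n] n (toℕ j))))))
                 (cancel (toℕ j) (coeff (P (n ∸ toℕ j ∸ 1))))) ⟩
          0# ∎

        L≈ : L (suc n) i ≈ p + recip (suc n) * Q
        L≈ = begin
          l                                              ≈⟨ recip-× (suc n) l ⟨
          recip (suc n) * (suc n ℕ× l)                   ≈⟨ *-congˡ (+-identityʳ _) ⟨
          -- Adding `Q + C`, which is zero, completes the left side of `log-recurrence` with `C` and
          -- leaves `Q` over.
          recip (suc n) * (suc n ℕ× l + 0#)              ≈⟨ *-congˡ (+-congˡ Q+C≈0) ⟨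
          recip (suc n) * (suc n ℕ× l + (Q + C))
            ≈⟨ *-congˡ (solve 3 (λ l q c → l :+ (q :+ c) := (l :+ c) :+ q) refl _ Q C) ⟩
          recip (suc n) * ((suc n ℕ× l + C) + Q)         ≈⟨ *-congˡ (+-congʳ (log-recurrence n i)) ⟩
          recip (suc n) * (suc n ℕ× p + Q)               ≈⟨ distribˡ _ _ _ ⟩
          recip (suc n) * (suc n ℕ× p) + recip (suc n) * Q  ≈⟨ +-congʳ (recip-× (suc n) p) ⟩
          p + recip (suc n) * Q                          ∎
          where
          l = L (suc n) i

-- Specialisation to the complex numbers

open import Defs

theorem4p4 : (V : Series) (V₀ : term V 0 ≈ₚ 1ₚ) →
    V ≈ₛ 1ₛ +ₛ y/x -ₛ x⁻¹ *ₛ V -ₛ ∂x V -ₛ x⁻¹ *ₛ ∂y V +ₛ x⁻¹ *ₛ log V V₀ →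
    let
    P : ℕ → Poly
    P n = term V (suc n)
    in
    (P 0 ≈ₚ Y -ₚ 1ₚ) ×
    ((n : ℕ) .{{_ : NonZero n}} →
    P n ≈ₚ ι n · P (n ∸ 1) -ₚ P (n ∸ 1) ′
    +ₚ ℂ-recip n · ∑[1⋯ n ∸ 1 ] (λ k →
    ι k · ((ι (k ∸ 1) · P (k ∸ 1) -ₚ P k -ₚ P (k ∸ 1) ′) *ₚ P (n ∸ k ∸ 1))))
theorem4p4 V V₀ V-solves = P-zero V V₀ V-solves , recurrence V V₀ V-solves
  where
  open LogEquation ℂ-commutativeRing ℂ-recip ℂ-recip-inverse
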